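{- Let $G$ be a unicyclic graph with $n \ge 4$ vertices and maximum degree $\Delta \ge 3$, let $q=\lfloor \frac{n}{\Delta-1}\rfloor$, and let $f : [1,\infty) \to \mathbb{R}$ be a convex function. If $q=1$ or $n=2\Delta-2$, then $$ I_f(G) \le f(\Delta) + f(n-\Delta+1) + f(2) + (n-3) f(1). $$ If $q>1$ and $n\ne 2\Delta-2$, then $$ I_f(G) \le q f(\Delta) + f\big(n-q(\Delta-1)+1\big) + (n-q-1) f(1). $$ The inequalities are attained (i.e., equality holds in the respective case) if and only if $G \in \mathcal{K}_n^\Delta$.
   Context: All graphs are finite, connected, simple (no loops, no multiple edges) and have at least one edge. A unicyclic graph is a graph containing exactly one cycle. For a vertex $u$ of $G$, $d_u$ denotes its degree. For a function $f:[1,\infty)\to\mathbb{R}$, $I_f(G) = \sum_{u\in V(G)} f(d_u)$. For $n\ge 4$, $3\le\Delta\le n-1$ and $q=\lfloor \frac{n}{\Delta-1}\rfloor$, define the $n$-tuple $\mathbf{z}$ as follows. If $q=1$ or $n=2\Delta-2$, then $\mathbf{z}=(\Delta,\,n-\Delta+1,\,2,\,1,\dots,1)$ with $n-3$ entries equal to $1$ at the end. If $q\ge 2$ and $n\ne 2\Delta-2$, then $\mathbf{z}=(z_1,\dots,z_n)$ with $z_j=\Delta$ for $1\le j\le q$, $z_{q+1}=n-q(\Delta-1)+1$, and $z_j=1$ for $q+1<j\le n$. $\mathcal{K}_n^\Delta$ is the set of unicyclic graphs with $n$ vertices whose degree sequence (in non-increasing order) is $\mathbf{z}$.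
   Formalization: For constant f equality can hold with G not in K (n=6, Δ=3, degrees 3,2,2,2,2,1), so "attained only if G in K" is stated for each strictly convex f, and for equality holding for all convex f at once; "if" is kept for every convex f. -}

module Defs where

open import Level using (0ℓ)
open import Data.Bool using (Bool; false; T; if_then_else_)
open import Data.Fin using (Fin)
open import Data.Fin.Subset using (Subset; ∣_∣; _∈_)
open import Data.Fin.Subset.Properties using (p⊆q⇒∣p∣≤∣q∣; x∈⁅y⁆⇒x≡y; ∣⁅x⁆∣≡1)
import Data.Integer as ℤ
import Data.Integer.Properties as ℤₚ
open import Data.List using (List; []; _∷_; _++_; _∷ʳ_; length; map; foldr; allFin; replicate)
open import Data.List.Relation.Unary.Linked using (Linked)
open import Data.List.Relation.Unary.Unique.Propositional using (Unique)
open import Data.List.Relation.Binary.Permutation.Propositional using (_↭_)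
open import Data.Nat as ℕ using (ℕ; suc; _⊔_; _∸_; _/_; NonZero)
import Data.Nat.Coprimality as Coprimality
import Data.Nat.Properties as ℕₚ
open import Data.Product using (Σ; ∃; ∃₂; ∃-syntax; _×_; _,_; proj₁; proj₂)
open import Data.Rational as ℚ using (ℚ; 0ℚ; 1ℚ; ½)
import Data.Rational.Properties as ℚₚ
open import Data.Rational.Solver using (module +-*-Solver)
open import Data.Sum using (_⊎_)
open import Data.Vec using (tabulate)
import Data.Vec.Properties as Vecₚ
open import Data.Bool.Properties using (T-≡)
open import Function.Bundles using (Func; _⟨$⟩_; _⇔_; Equivalence)
open import Relation.Binary using (Setoid; IsEquivalence)
open import Relation.Binary.Construct.Closure.ReflexiveTransitive using (Star; ε; _◅_)
import Relation.Binary.Construct.On as On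
open import Relation.Binary.PropositionalEquality
  using (_≡_; refl; sym; trans; cong; cong₂; subst; subst₂)
open import Relation.Nullary.Decidable using (does; _⊎-dec_)

------------------------------------------------------------------------
-- Real numbers, as Cauchy sequences of rationals (with modulus)

private

  half : ℚ → ℚ
  half δ = δ ℚ.* ½

  half-pos : ∀ {δ} → 0ℚ ℚ.< δ → 0ℚ ℚ.< half δ
  half-pos {δ} 0<δ = ℚₚ.positive⁻¹ (half δ)
    {{ℚₚ.pos*pos⇒pos δ {{ℚ.positive 0<δ}} ½}}

  half+half : ∀ δ → half δ ℚ.+ half δ ≡ δ
  half+half δ = trans (sym (ℚₚ.*-distribˡ-+ δ ½ ½)) (ℚₚ.*-identityʳ δ)

  dist : ℚ → ℚ → ℚ
  dist p q = ℚ.∣ p ℚ.- q ∣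

  dist-refl : ∀ p → dist p p ≡ 0ℚ
  dist-refl p = cong ℚ.∣_∣ (ℚₚ.+-inverseʳ p)

  dist-sym : ∀ p q → dist p q ≡ dist q p
  dist-sym p q = trans (cong ℚ.∣_∣ lem) (ℚₚ.∣-p∣≡∣p∣ (q ℚ.- p))
    where
    open +-*-Solver
    lem : p ℚ.- q ≡ ℚ.- (q ℚ.- p)
    lem = solve 2 (λ p q → p :- q := :- (q :- p)) refl p q

  dist-triangle : ∀ p q r → dist p r ℚ.≤ dist p q ℚ.+ dist q r
  dist-triangle p q r = subst (ℚ._≤ dist p q ℚ.+ dist q r) (cong ℚ.∣_∣ lem)
    (ℚₚ.∣p+q∣≤∣p∣+∣q∣ (p ℚ.- q) (q ℚ.- r))
    where
    open +-*-Solver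
    lem : (p ℚ.- q) ℚ.+ (q ℚ.- r) ≡ p ℚ.- r
    lem = solve 3 (λ p q r → (p :- q) :+ (q :- r) := p :- r) refl p q r

  dist-+ : ∀ p q r s → dist (p ℚ.+ q) (r ℚ.+ s) ℚ.≤ dist p r ℚ.+ dist q s
  dist-+ p q r s = subst (ℚ._≤ dist p r ℚ.+ dist q s) (cong ℚ.∣_∣ lem)
    (ℚₚ.∣p+q∣≤∣p∣+∣q∣ (p ℚ.- r) (q ℚ.- s))
    where
    open +-*-Solver
    lem : (p ℚ.- r) ℚ.+ (q ℚ.- s) ≡ (p ℚ.+ q) ℚ.- (r ℚ.+ s)
    lem = solve 4 (λ p q r s → (p :- r) :+ (q :- s) := (p :+ q) :- (r :+ s)) refl p q r s

  dist-neg : ∀ p q → dist (ℚ.- p) (ℚ.- q) ≡ dist p q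
  dist-neg p q = trans (cong ℚ.∣_∣ lem) (ℚₚ.∣-p∣≡∣p∣ (p ℚ.- q))
    where
    open +-*-Solver
    lem : ℚ.- p ℚ.- ℚ.- q ≡ ℚ.- (p ℚ.- q)
    lem = solve 2 (λ p q → :- p :- :- q := :- (p :- q)) refl p q

  dist-* : ∀ p q r s →
           dist (p ℚ.* q) (r ℚ.* s) ℚ.≤ ℚ.∣ p ∣ ℚ.* dist q s ℚ.+ ℚ.∣ s ∣ ℚ.* dist p r
  dist-* p q r s = subst₂ ℚ._≤_ (cong ℚ.∣_∣ lem)
    (cong₂ ℚ._+_ (ℚₚ.∣p*q∣≡∣p∣*∣q∣ p (q ℚ.- s)) (ℚₚ.∣p*q∣≡∣p∣*∣q∣ s (p ℚ.- r)))
    (ℚₚ.∣p+q∣≤∣p∣+∣q∣ (p ℚ.* (q ℚ.- s)) (s ℚ.* (p ℚ.- r)))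
    where
    open +-*-Solver
    lem : p ℚ.* (q ℚ.- s) ℚ.+ s ℚ.* (p ℚ.- r) ≡ p ℚ.* q ℚ.- r ℚ.* s
    lem = solve 4 (λ p q r s → p :* (q :- s) :+ s :* (p :- r) := p :* q :- r :* s) refl p q r s

Eventually : (ℕ → Set) → Set
Eventually P = ∃[ N ] (∀ n → N ℕ.≤ n → P n)

record ℝ : Set where
  field
    seq    : ℕ → ℚ
    cauchy : ∀ δ → 0ℚ ℚ.< δ →
             ∃[ N ] (∀ m n → N ℕ.≤ m → N ℕ.≤ n → ℚ.∣ seq m ℚ.- seq n ∣ ℚ.≤ δ)

open ℝ public

infix 4 _≈ℝ_ _≤ℝ_ _<ℝ_

_≈ℝ_ : ℝ → ℝ → Set
x ≈ℝ y = ∀ δ → 0ℚ ℚ.< δ → Eventually λ n → ℚ.∣ seq x n ℚ.- seq y n ∣ ℚ.≤ δ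

_≤ℝ_ : ℝ → ℝ → Set
x ≤ℝ y = ∀ δ → 0ℚ ℚ.< δ → Eventually λ n → seq x n ℚ.≤ seq y n ℚ.+ δ

_<ℝ_ : ℝ → ℝ → Set
x <ℝ y = ∃[ δ ] (0ℚ ℚ.< δ × Eventually λ n → seq x n ℚ.+ δ ℚ.≤ seq y n)

≈ℝ-isEquivalence : IsEquivalence _≈ℝ_
≈ℝ-isEquivalence = record
  { refl  = λ {x} δ 0<δ → 0 , λ n _ →
      subst (ℚ._≤ δ) (sym (dist-refl (seq x n))) (ℚₚ.<⇒≤ 0<δ)
  ; sym   = λ {x} {y} x≈y δ 0<δ → proj₁ (x≈y δ 0<δ) , λ n N≤n →
      subst (ℚ._≤ δ) (dist-sym (seq x n) (seq y n)) (proj₂ (x≈y δ 0<δ) n N≤n)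
  ; trans = λ {x} {y} {z} x≈y y≈z δ 0<δ →
      let M , p = x≈y (half δ) (half-pos 0<δ)
          N , q = y≈z (half δ) (half-pos 0<δ)
      in M ⊔ N , λ n le → ℚₚ.≤-trans (dist-triangle (seq x n) (seq y n) (seq z n))
           (ℚₚ.≤-trans (ℚₚ.+-mono-≤ (p n (ℕₚ.m⊔n≤o⇒m≤o M N le)) (q n (ℕₚ.m⊔n≤o⇒n≤o M N le)))
                       (ℚₚ.≤-reflexive (half+half δ)))
  }

ℝ-setoid : Setoid 0ℓ 0ℓ
ℝ-setoid = record { isEquivalence = ≈ℝ-isEquivalence }

fromℚ : ℚ → ℝ
fromℚ p = record
  { seq    = λ _ → p
  ; cauchy = λ δ 0<δ → 0 , λ _ _ _ _ → subst (ℚ._≤ δ) (sym (dist-refl p)) (ℚₚ.<⇒≤ 0<δ)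
  }

fromℕ : ℕ → ℝ
fromℕ k = fromℚ (ℤ.+ k ℚ./ 1)

0ℝ 1ℝ : ℝ
0ℝ = fromℕ 0
1ℝ = fromℕ 1

infixl 6 _+ℝ_ _-ℝ_
infixl 7 _*ℝ_
infix  8 -ℝ_

_+ℝ_ : ℝ → ℝ → ℝ
x +ℝ y = record
  { seq    = λ n → seq x n ℚ.+ seq y n
  ; cauchy = λ δ 0<δ →
      let M , p = cauchy x (half δ) (half-pos 0<δ)
          N , q = cauchy y (half δ) (half-pos 0<δ)
      in M ⊔ N , λ m n le le′ →
           ℚₚ.≤-trans (dist-+ (seq x m) (seq y m) (seq x n) (seq y n))
           (ℚₚ.≤-trans (ℚₚ.+-mono-≤
              (p m n (ℕₚ.m⊔n≤o⇒m≤o M N le) (ℕₚ.m⊔n≤o⇒m≤o M N le′))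
              (q m n (ℕₚ.m⊔n≤o⇒n≤o M N le) (ℕₚ.m⊔n≤o⇒n≤o M N le′)))
           (ℚₚ.≤-reflexive (half+half δ)))
  }

-ℝ_ : ℝ → ℝ
-ℝ x = record
  { seq    = λ n → ℚ.- seq x n
  ; cauchy = λ δ 0<δ → proj₁ (cauchy x δ 0<δ) , λ m n le le′ →
      subst (ℚ._≤ δ) (sym (dist-neg (seq x m) (seq x n))) (proj₂ (cauchy x δ 0<δ) m n le le′)
  }

_-ℝ_ : ℝ → ℝ → ℝ
x -ℝ y = x +ℝ (-ℝ y)

eventually-bounded : ∀ x → ∃[ B ] (0ℚ ℚ.< B × Eventually λ n → ℚ.∣ seq x n ∣ ℚ.≤ B)
eventually-bounded x with cauchy x 1ℚ (ℚₚ.positive⁻¹ 1ℚ)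
... | N , p = ℚ.∣ a ∣ ℚ.+ 1ℚ
            , ℚₚ.<-≤-trans (ℚₚ.positive⁻¹ 1ℚ)
                (subst (ℚ._≤ ℚ.∣ a ∣ ℚ.+ 1ℚ) (ℚₚ.+-identityˡ 1ℚ)
                  (ℚₚ.+-monoˡ-≤ 1ℚ (ℚₚ.0≤∣p∣ a)))
            , N , λ n N≤n → subst (ℚ._≤ ℚ.∣ a ∣ ℚ.+ 1ℚ) (cong ℚ.∣_∣ (lem (seq x n)))
                (ℚₚ.≤-trans (ℚₚ.∣p+q∣≤∣p∣+∣q∣ a (seq x n ℚ.- a))
                  (ℚₚ.+-monoʳ-≤ ℚ.∣ a ∣ (p n N N≤n ℕₚ.≤-refl)))
  where
  a = seq x N
  lem : ∀ b → a ℚ.+ (b ℚ.- a) ≡ b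
  lem b = solve 2 (λ a b → a :+ (b :- a) := b) refl a b
    where open +-*-Solver

private

  *-mono-≤′ : ∀ {p q r s} → 0ℚ ℚ.≤ r → 0ℚ ℚ.≤ q → p ℚ.≤ q → r ℚ.≤ s → p ℚ.* r ℚ.≤ q ℚ.* s
  *-mono-≤′ {p} {q} {r} {s} 0≤r 0≤q p≤q r≤s = ℚₚ.≤-trans
    (ℚₚ.*-monoʳ-≤-nonNeg r {{ℚ.nonNegative 0≤r}} p≤q)
    (ℚₚ.*-monoˡ-≤-nonNeg q {{ℚ.nonNegative 0≤q}} r≤s)

  scale : ∀ C → 0ℚ ℚ.< C → ∀ δ → 0ℚ ℚ.< δ → ∃[ η ] (0ℚ ℚ.< η × C ℚ.* η ≡ δ)
  scale C 0<C δ 0<δ = 1/C ℚ.* δ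
    , ℚₚ.positive⁻¹ (1/C ℚ.* δ)
        {{ℚₚ.pos*pos⇒pos 1/C {{ℚₚ.1/pos⇒pos C {{C>0}}}} δ {{ℚ.positive 0<δ}}}}
    , trans (sym (ℚₚ.*-assoc C 1/C δ))
        (trans (cong (ℚ._* δ) (ℚₚ.*-inverseʳ C {{C≢0}})) (ℚₚ.*-identityˡ δ))
    where
    C>0 : ℚ.Positive C
    C>0 = ℚ.positive 0<C
    C≢0 : ℚ.NonZero C
    C≢0 = ℚₚ.pos⇒nonZero C {{C>0}}
    1/C : ℚ
    1/C = ℚ.1/_ C {{C≢0}}

_*ℝ_ : ℝ → ℝ → ℝ
x *ℝ y = record
  { seq    = λ n → seq x n ℚ.* seq y n
  ; cauchy = λ δ 0<δ →
      let B , 0<B , K , b = eventually-bounded x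
          C , 0<C , L , c = eventually-bounded y
          η , 0<η , eq = scale (B ℚ.+ C) (ℚₚ.+-mono-< 0<B 0<C) δ 0<δ
          M , p = cauchy x η 0<η
          N , q = cauchy y η 0<η
          S = (K ⊔ L) ⊔ (M ⊔ N)
      in S , λ m n le le′ →
           let KL≤m = ℕₚ.m⊔n≤o⇒m≤o (K ⊔ L) (M ⊔ N) le
               KL≤n = ℕₚ.m⊔n≤o⇒m≤o (K ⊔ L) (M ⊔ N) le′
               MN≤m = ℕₚ.m⊔n≤o⇒n≤o (K ⊔ L) (M ⊔ N) le
               MN≤n = ℕₚ.m⊔n≤o⇒n≤o (K ⊔ L) (M ⊔ N) le′
           in ℚₚ.≤-trans (dist-* (seq x m) (seq y m) (seq x n) (seq y n))
             (ℚₚ.≤-trans (ℚₚ.+-mono-≤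
                (*-mono-≤′ (ℚₚ.0≤∣p∣ _) (ℚₚ.<⇒≤ 0<B)
                   (b m (ℕₚ.m⊔n≤o⇒m≤o K L KL≤m))
                   (q m n (ℕₚ.m⊔n≤o⇒n≤o M N MN≤m) (ℕₚ.m⊔n≤o⇒n≤o M N MN≤n)))
                (*-mono-≤′ (ℚₚ.0≤∣p∣ _) (ℚₚ.<⇒≤ 0<C)
                   (c n (ℕₚ.m⊔n≤o⇒n≤o K L KL≤n))
                   (p m n (ℕₚ.m⊔n≤o⇒m≤o M N MN≤m) (ℕₚ.m⊔n≤o⇒m≤o M N MN≤n))))
             (ℚₚ.≤-reflexive (trans (sym (ℚₚ.*-distribʳ-+ η B C)) eq)))
  }

------------------------------------------------------------------------
-- Functions on [1,∞)

[1,∞⟩ : Set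
[1,∞⟩ = Σ ℝ (1ℝ ≤ℝ_)

[1,∞⟩-setoid : Setoid 0ℓ 0ℓ
[1,∞⟩-setoid = record
  { Carrier       = [1,∞⟩
  ; _≈_           = λ x y → proj₁ x ≈ℝ proj₁ y
  ; isEquivalence = On.isEquivalence proj₁ ≈ℝ-isEquivalence
  }

RealFunction : Set
RealFunction = Func [1,∞⟩-setoid ℝ-setoid

-- The convex combination is named by a point z of [1,∞); since f respects
-- ≈ℝ, its value does not depend on the representative z chosen.
Convex : RealFunction → Set
Convex f = ∀ (x y z : [1,∞⟩) (t : ℝ) → 0ℝ ≤ℝ t → t ≤ℝ 1ℝ →
  proj₁ z ≈ℝ t *ℝ proj₁ x +ℝ (1ℝ -ℝ t) *ℝ proj₁ y →
  f ⟨$⟩ z ≤ℝ t *ℝ (f ⟨$⟩ x) +ℝ (1ℝ -ℝ t) *ℝ (f ⟨$⟩ y)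

-- Requiring x <ℝ y rather than x ≠ y loses nothing: exchange x and y, and
-- t and 1 - t.
StrictlyConvex : RealFunction → Set
StrictlyConvex f = ∀ (x y z : [1,∞⟩) (t : ℝ) → proj₁ x <ℝ proj₁ y → 0ℝ <ℝ t → t <ℝ 1ℝ →
  proj₁ z ≈ℝ t *ℝ proj₁ x +ℝ (1ℝ -ℝ t) *ℝ proj₁ y →
  f ⟨$⟩ z <ℝ t *ℝ (f ⟨$⟩ x) +ℝ (1ℝ -ℝ t) *ℝ (f ⟨$⟩ y)

private

  k/1≡ : ∀ k → ℤ.+ k ℚ./ 1 ≡ ℚ.mkℚ (ℤ.+ k) 0 (Coprimality.sym (Coprimality.1-coprimeTo k))
  k/1≡ k = ℚₚ.normalize-coprime (Coprimality.sym (Coprimality.1-coprimeTo k))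

  fromℕ-mono : ∀ {j k} → j ℕ.≤ k → fromℕ j ≤ℝ fromℕ k
  fromℕ-mono {j} {k} j≤k δ 0<δ = 0 , λ _ _ →
    ℚₚ.≤-trans (subst₂ ℚ._≤_ (sym (k/1≡ j)) (sym (k/1≡ k))
                  (ℚ.*≤* (ℤₚ.*-monoʳ-≤-nonNeg (ℤ.+ 1) (ℤ.+≤+ j≤k))))
      (subst (ℚ._≤ ℤ.+ k ℚ./ 1 ℚ.+ δ) (ℚₚ.+-identityʳ (ℤ.+ k ℚ./ 1))
        (ℚₚ.+-monoʳ-≤ (ℤ.+ k ℚ./ 1) (ℚₚ.<⇒≤ 0<δ)))

point : (k : ℕ) → 1 ℕ.≤ k → [1,∞⟩
point k 1≤k = fromℕ k , fromℕ-mono 1≤k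

------------------------------------------------------------------------
-- Graphs

-- Finite simple connected graphs on the vertex set Fin n with at least
-- one edge.
record Graph (n : ℕ) : Set where
  field
    adj       : Fin n → Fin n → Bool
    symmetric : ∀ u v → adj u v ≡ adj v u
    loopless  : ∀ u → adj u u ≡ false

  Adj : Fin n → Fin n → Set
  Adj u v = T (adj u v)

  field
    connected : ∀ u v → Star Adj u v
    hasEdge   : ∃₂ Adj

  neighbours : Fin n → Subset n
  neighbours u = tabulate (adj u)

  degree : Fin n → ℕ
  degree u = ∣ neighbours u ∣

  degrees : List ℕ
  degrees = map degree (allFin n)

  degree≥1 : ∀ u → 1 ℕ.≤ degree u
  degree≥1 u = subst (ℕ._≤ degree u) (∣⁅x⁆∣≡1 (proj₁ neighbour))
    (p⊆q⇒∣p∣≤∣q∣ λ w∈⁅v⁆ →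
      subst (_∈ neighbours u) (sym (x∈⁅y⁆⇒x≡y _ w∈⁅v⁆)) v∈N)
    where
    neighbour : ∃ (Adj u)
    neighbour with connected u (proj₁ hasEdge)
    ... | ε         = proj₂ hasEdge
    ... | _◅_ u~v _ = _ , u~v
    v∈N : proj₁ neighbour ∈ neighbours u
    v∈N = Vecₚ.lookup⇒[]= _ _ (trans (Vecₚ.lookup∘tabulate (adj u) _)
            (Equivalence.to T-≡ (proj₂ neighbour)))

module _ {n : ℕ} (G : Graph n) where
  open Graph G

  -- A cycle, presented by its vertices in cyclic order from a start vertex.
  record Cycle : Set where
    field
      start    : Fin n
      rest     : List (Fin n)
      distinct : Unique (start ∷ rest)
      long     : 3 ℕ.≤ length (start ∷ rest)
      closed   : Linked Adj ((start ∷ rest) ∷ʳ start)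

    Consecutive : Fin n → Fin n → Set
    Consecutive u v = ∃₂ λ xs ys → (start ∷ rest) ∷ʳ start ≡ xs ++ u ∷ v ∷ ys

    IsEdge : Fin n → Fin n → Set
    IsEdge u v = Consecutive u v ⊎ Consecutive v u

  -- Presentations differing by rotation or reversal are the same cycle of
  -- the graph, so cycles are compared as sets of edges.
  SameCycle : Cycle → Cycle → Set
  SameCycle c c′ = ∀ u v → Cycle.IsEdge c u v ⇔ Cycle.IsEdge c′ u v

  Unicyclic : Set
  Unicyclic = ∃[ c ] (∀ c′ → SameCycle c c′)

  IsMaxDegree : ℕ → Set
  IsMaxDegree Δ = (∀ u → degree u ℕ.≤ Δ) × ∃[ u ] degree u ≡ Δ

  -- zs is the degree sequence in non-increasing order.
  IsDegreeSequence : List ℕ → Set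
  IsDegreeSequence zs = Linked ℕ._≥_ zs × zs ↭ degrees

  I : RealFunction → ℝ
  I f = foldr _+ℝ_ 0ℝ (map (λ u → f ⟨$⟩ point (degree u) (degree≥1 u)) (allFin n))

------------------------------------------------------------------------
-- The extremal class

-- q = ⌊n / (Δ - 1)⌋
quotient : (n Δ : ℕ) → 3 ℕ.≤ Δ → ℕ
quotient n Δ 3≤Δ = _/_ n (Δ ∸ 1) {{ℕ.>-nonZero (ℕₚ.m<n⇒0<n∸m (ℕₚ.≤-trans (ℕₚ.n≤1+n 2) 3≤Δ))}}

-- The truncated subtractions agree with the integer ones for n ≥ 4 and
-- 3 ≤ Δ ≤ n - 1.
extremalSequence : (n Δ : ℕ) → 3 ℕ.≤ Δ → List ℕ
extremalSequence n Δ 3≤Δ =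
  let q = quotient n Δ 3≤Δ in
  if does ((q ℕ.≟ 1) ⊎-dec (n ℕ.≟ 2 ℕ.* Δ ∸ 2))
  then Δ ∷ (n ∸ Δ ℕ.+ 1) ∷ 2 ∷ replicate (n ∸ 3) 1
  else replicate q Δ ++ (n ∸ q ℕ.* (Δ ∸ 1) ℕ.+ 1) ∷ replicate (n ∸ (q ℕ.+ 1)) 1

-- Membership of a graph on n vertices in the class 𝒦.
In𝒦 : {n : ℕ} (Δ : ℕ) → 3 ℕ.≤ Δ → Graph n → Set
In𝒦 {n} Δ 3≤Δ G = Unicyclic G × IsDegreeSequence G (extremalSequence n Δ 3≤Δ)

------------------------------------------------------------------------
-- Sharp upper bounds

-- f ↦ B f bounds I_f(G) for every convex f, and the bound is attained
-- exactly when P holds.  For a fixed convex f that is not strictly convex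
-- (a constant, say) equality can hold without P, so attainment is expressed
-- both uniformly over all convex f and for each strictly convex f.
SharpUpperBound : {n : ℕ} → Graph n → (RealFunction → ℝ) → Set → Set
SharpUpperBound G B P =
    (∀ f → Convex f → I G f ≤ℝ B f)
  × ((∀ f → Convex f → I G f ≈ℝ B f) ⇔ P)
  × (∀ f → StrictlyConvex f → (I G f ≈ℝ B f ⇔ P))

{-# OPTIONS --safe #-}

-- A unicyclic graph on n vertices has an orientation with all out-degrees 1:
-- grow a tree along the cycle and then through the remaining vertices, point
-- every vertex to its parent and the root to the last vertex of the cycle. An
-- edge not used by this orientation would lie on a second cycle. Hence the
-- numbers d - 1, with d ranging over the degrees, are the in-degrees and have
-- sum n. Moving two of these numbers apart while keeping their sum increases
-- I_f for convex f, strictly so for strictly convex f, and repeating such moves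
-- leads to the extremal degree sequence. In the first case this uses that there
-- are two vertices of degree at least 2 besides a vertex of maximum degree.
module Submission where

open import Defs
open import Data.Nat using (ℕ; _+_; _*_; _∸_; _≤_; _<_)
open import Data.Nat.Properties using (≤-refl; ≤-trans; m≤n+m)
open import Data.Product using (_×_)
open import Data.Sum using (_⊎_)
open import Function.Bundles using (_⟨$⟩_)
open import Relation.Binary.PropositionalEquality using (_≡_; _≢_)

open import Data.Bool using (Bool; true; false; T; if_then_else_)
open import Data.Bool.Properties using (T-≡)
open import Data.Empty using (⊥-elim)
open import Data.Fin using (Fin; zero; suc)
import Data.Fin.Properties as Finₚ
open import Data.Fin.Subset using (∣_∣)
import Data.Integer as ℤ
import Data.Integer.Properties as ℤₚ
open import Data.List using (List; []; _∷_; _++_; _∷ʳ_; map; foldr; length; replicate; allFin)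
import Data.List as List
import Data.List.Properties as Listₚ
open import Data.List.Membership.Propositional using (_∈_; _∉_)
open import Data.List.Membership.Propositional.Properties using (∈-allFin; ∈-∃++)
open import Data.List.Relation.Binary.Permutation.Propositional as Perm using (_↭_; ↭-sym)
open import Data.List.Relation.Binary.Permutation.Propositional.Properties
  using (shift; map⁺; ↭-length; ∈-resp-↭)
open import Data.List.Relation.Unary.All as All using (All; []; _∷_)
import Data.List.Relation.Unary.All.Properties as Allₚ
open import Data.List.Relation.Unary.AllPairs using ([]; _∷_)
open import Data.List.Relation.Unary.Any using (here; there)
open import Data.List.Relation.Unary.Linked as Linked using (Linked; []; [-]; _∷_)
import Data.List.Relation.Unary.Linked.Properties as Linkedₚ
open import Data.List.Relation.Unary.Unique.Propositional using (Unique)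
import Data.Nat as ℕ
open import Data.Nat using (zero; suc; _/_; _≥_; _⊔_; z≤n; s≤s; s≤s⁻¹; NonZero)
open import Data.Nat.Divisibility using (divides)
import Data.Nat.DivMod as DivMod
open import Data.Nat.ListAction using (sum)
open import Data.Nat.ListAction.Properties using (sum-↭; sum-++)
import Data.Nat.Properties as ℕₚ
open import Data.Nat.Tactic.RingSolver using (solve-∀)
open import Data.Product using (∃-syntax; Σ-syntax; _,_; proj₁; proj₂)
open import Data.Rational as ℚ using (ℚ; 0ℚ; 1ℚ; ½)
import Data.Rational.Properties as ℚₚ
open import Data.Rational.Solver using (module +-*-Solver)
import Data.Rational.Unnormalised as ℚᵘ
import Data.Rational.Unnormalised.Properties as ℚᵘₚ
open import Data.Sum as Sum using (inj₁; inj₂; [_,_]′)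
import Data.Vec as Vec
open import Function using (_∘_; id)
open import Function.Bundles using (Equivalence; mk⇔)
open import Relation.Binary using (IsEquivalence)
open import Relation.Binary.Construct.Closure.ReflexiveTransitive as Star using (Star; ε; _◅_; _◅◅_)
open import Relation.Binary.PropositionalEquality
  using (refl; sym; trans; cong; cong₂; subst; subst₂)
open import Relation.Nullary using (¬_; yes; no; does)
open import Relation.Nullary.Decidable using (dec-true; dec-false; _⊎-dec_; decidable-stable)
open import Algebra.Properties.CommutativeMonoid.Sum ℕₚ.+-0-commutativeMonoid
  using (∑-distrib-+; ∑-comm; sum-cong-≗) renaming (sum to ∑)

open +-*-Solver using (solve; _:+_; _:*_; _:-_; _:=_; con; :-_)
open IsEquivalence ≈ℝ-isEquivalence
  using () renaming (refl to ≈-refl; sym to ≈-sym; trans to ≈-trans)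

-- Arithmetic of real numbers

halve : ∀ {δ} → 0ℚ ℚ.< δ → ∃[ h ] (0ℚ ℚ.< h × h ℚ.+ h ≡ δ)
halve {δ} 0<δ = δ ℚ.* ½
  , ℚₚ.positive⁻¹ (δ ℚ.* ½) {{ℚₚ.pos*pos⇒pos δ {{ℚ.positive 0<δ}} ½}}
  , trans (sym (ℚₚ.*-distribˡ-+ δ ½ ½)) (ℚₚ.*-identityʳ δ)

-- Rational inequalities are deduced from others through a ring identity.
≤-shift : ∀ {a b c d} → a ℚ.≤ b → c ℚ.+ b ≡ d ℚ.+ a → c ℚ.≤ d
≤-shift {a} {b} {c} {d} a≤b eq = subst₂ ℚ._≤_
  (trans (cong (ℚ._- b) (sym eq)) (cancel c)) (cancel d)
  (ℚₚ.+-monoˡ-≤ (ℚ.- b) (ℚₚ.+-monoʳ-≤ d a≤b))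
  where
  cancel : ∀ e → e ℚ.+ b ℚ.- b ≡ e
  cancel e = solve 2 (λ e b → e :+ b :- b := e) refl e b

p≤p+ : ∀ p {δ} → 0ℚ ℚ.< δ → p ℚ.≤ p ℚ.+ δ
p≤p+ p {δ} 0<δ = ≤-shift (ℚₚ.<⇒≤ 0<δ) (solve 2 (λ p δ → p :+ δ := (p :+ δ) :+ con 0ℚ) refl p δ)

pointwise : ∀ {x y} → (∀ n → seq x n ≡ seq y n) → x ≈ℝ y
pointwise {x} {y} eq δ 0<δ = 0 , λ n _ → subst (ℚ._≤ δ)
  (cong ℚ.∣_∣ (trans (sym (ℚₚ.+-inverseʳ (seq x n))) (cong (λ e → seq x n ℚ.- e) (eq n))))
  (ℚₚ.<⇒≤ 0<δ)

pointwise-≤ : ∀ {x y} → (∀ n → seq x n ℚ.≤ seq y n) → x ≤ℝ y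
pointwise-≤ {x} {y} le δ 0<δ = 0 , λ n _ → ℚₚ.≤-trans (le n) (p≤p+ (seq y n) 0<δ)

p≤∣p∣ : ∀ p → p ℚ.≤ ℚ.∣ p ∣
p≤∣p∣ p@(ℚ.mkℚ (ℤ.+ _) _ _)    = ℚₚ.≤-refl
p≤∣p∣ p@(ℚ.mkℚ ℤ.-[1+ _ ] _ _) = ℚₚ.≤-trans (ℚₚ.nonPositive⁻¹ p) (ℚₚ.0≤∣p∣ p)

≈⇒≤ : ∀ {x y} → x ≈ℝ y → x ≤ℝ y
≈⇒≤ {x} {y} x≈y δ 0<δ = proj₁ (x≈y δ 0<δ) , λ n le →
  ≤-shift (ℚₚ.≤-trans (p≤∣p∣ (seq x n ℚ.- seq y n)) (proj₂ (x≈y δ 0<δ) n le))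
    (solve 3 (λ x y δ → x :+ δ := (y :+ δ) :+ (x :- y)) refl (seq x n) (seq y n) δ)

module _ {P Q R : ℕ → Set} where

  eventually₂ : (∀ n → P n → Q n → R n) → Eventually P → Eventually Q → Eventually R
  eventually₂ f (M , p) (N , q) = M ⊔ N , λ n le →
    f n (p n (ℕₚ.m⊔n≤o⇒m≤o M N le)) (q n (ℕₚ.m⊔n≤o⇒n≤o M N le))

≤ℝ-refl : ∀ {x} → x ≤ℝ x
≤ℝ-refl {x} = ≈⇒≤ {x} {x} (≈-refl {x})

≤ℝ-trans : ∀ {x y z} → x ≤ℝ y → y ≤ℝ z → x ≤ℝ z
≤ℝ-trans {x} {y} {z} x≤y y≤z δ 0<δ with halve 0<δ
... | h , 0<h , refl = eventually₂
  (λ n p q → ≤-shift (ℚₚ.+-mono-≤ p q)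
    (solve 4 (λ x y z h → x :+ ((y :+ h) :+ (z :+ h)) := (z :+ (h :+ h)) :+ (x :+ y))
      refl (seq x n) (seq y n) (seq z n) h))
  (x≤y h 0<h) (y≤z h 0<h)

+-mono-≤ℝ : ∀ {x y z w} → x ≤ℝ y → z ≤ℝ w → x +ℝ z ≤ℝ y +ℝ w
+-mono-≤ℝ {x} {y} {z} {w} x≤y z≤w δ 0<δ with halve 0<δ
... | h , 0<h , refl = eventually₂
  (λ n p q → ≤-shift (ℚₚ.+-mono-≤ p q)
    (solve 5 (λ x y z w h → (x :+ z) :+ ((y :+ h) :+ (w :+ h))
                              := (y :+ w :+ (h :+ h)) :+ (x :+ z))
      refl (seq x n) (seq y n) (seq z n) (seq w n) h))
  (x≤y h 0<h) (z≤w h 0<h)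

<⇒≤ℝ : ∀ {x y} → x <ℝ y → x ≤ℝ y
<⇒≤ℝ {x} {y} (γ , 0<γ , N , p) δ 0<δ = N , λ n le →
  ℚₚ.≤-trans (p≤p+ (seq x n) 0<γ) (ℚₚ.≤-trans (p n le) (p≤p+ (seq y n) 0<δ))

-- Half of the gap `γ` pays for the slack in `x ≤ℝ y`; the other half is the gap of the conclusion.
≤-<ℝ-trans : ∀ {x y z} → x ≤ℝ y → y <ℝ z → x <ℝ z
≤-<ℝ-trans {x} {y} {z} x≤y (γ , 0<γ , y<z) with halve 0<γ
... | h , 0<h , refl = h , 0<h , eventually₂
  (λ n p q → ≤-shift (ℚₚ.+-mono-≤ p q)
    (solve 4 (λ x y z h → (x :+ h) :+ ((y :+ h) :+ z) := z :+ (x :+ (y :+ (h :+ h))))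
      refl (seq x n) (seq y n) (seq z n) h))
  (x≤y h 0<h) y<z

<-≤ℝ-trans : ∀ {x y z} → x <ℝ y → y ≤ℝ z → x <ℝ z
<-≤ℝ-trans {x} {y} {z} (γ , 0<γ , x<y) y≤z with halve 0<γ
... | h , 0<h , refl = h , 0<h , eventually₂
  (λ n p q → ≤-shift (ℚₚ.+-mono-≤ p q)
    (solve 4 (λ x y z h → (x :+ h) :+ (y :+ (z :+ h)) := z :+ ((x :+ (h :+ h)) :+ y))
      refl (seq x n) (seq y n) (seq z n) h))
  x<y (y≤z h 0<h)

+-mono-<-≤ℝ : ∀ {x y z w} → x <ℝ y → z ≤ℝ w → x +ℝ z <ℝ y +ℝ w
+-mono-<-≤ℝ {x} {y} {z} {w} (γ , 0<γ , x<y) z≤w with halve 0<γ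
... | h , 0<h , refl = h , 0<h , eventually₂
  (λ n p q → ≤-shift (ℚₚ.+-mono-≤ p q)
    (solve 5 (λ x y z w h → (x :+ z :+ h) :+ (y :+ (w :+ h))
                              := (y :+ w) :+ ((x :+ (h :+ h)) :+ z))
      refl (seq x n) (seq y n) (seq z n) (seq w n) h))
  x<y (z≤w h 0<h)

<ℝ-irrefl : ∀ {x} → ¬ (x <ℝ x)
<ℝ-irrefl {x} (γ , 0<γ , N , p) = ℚₚ.<-irrefl refl (ℚₚ.<-≤-trans 0<γ
  (≤-shift {c = γ} {d = 0ℚ} (p N ≤-refl)
    (solve 2 (λ x γ → γ :+ x := con 0ℚ :+ (x :+ γ)) refl (seq x N) γ)))

<ℝ⇒≉ : ∀ {x y} → x <ℝ y → ¬ (x ≈ℝ y)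
<ℝ⇒≉ {x} {y} x<y x≈y = <ℝ-irrefl {x}
  (<-≤ℝ-trans {x} {y} {x} x<y (≈⇒≤ {y} {x} (≈-sym {x} {y} x≈y)))

+ℝ-cong : ∀ {x y z w} → x ≈ℝ y → z ≈ℝ w → x +ℝ z ≈ℝ y +ℝ w
+ℝ-cong {x} {y} {z} {w} x≈y z≈w δ 0<δ with halve 0<δ
... | h , 0<h , refl = eventually₂
  (λ n p q → ℚₚ.≤-trans
    (subst (ℚ._≤ ℚ.∣ seq x n ℚ.- seq y n ∣ ℚ.+ ℚ.∣ seq z n ℚ.- seq w n ∣) (cong ℚ.∣_∣
        (solve 4 (λ x y z w → (x :- y) :+ (z :- w) := (x :+ z) :- (y :+ w)) refl
          (seq x n) (seq y n) (seq z n) (seq w n)))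
      (ℚₚ.∣p+q∣≤∣p∣+∣q∣ (seq x n ℚ.- seq y n) (seq z n ℚ.- seq w n)))
    (ℚₚ.+-mono-≤ p q))
  (x≈y h 0<h) (z≈w h 0<h)

+ℝ-comm : ∀ x y → x +ℝ y ≈ℝ y +ℝ x
+ℝ-comm x y = pointwise {x +ℝ y} {y +ℝ x} λ n → ℚₚ.+-comm (seq x n) (seq y n)

divide : ∀ C → 0ℚ ℚ.< C → ∀ δ → 0ℚ ℚ.< δ → ∃[ η ] (0ℚ ℚ.< η × η ℚ.* C ≡ δ)
divide C 0<C δ 0<δ = δ ℚ.* C⁻¹
  , ℚₚ.positive⁻¹ (δ ℚ.* C⁻¹) {{ℚₚ.pos*pos⇒pos δ {{ℚ.positive 0<δ}} C⁻¹ {{ℚₚ.1/pos⇒pos C {{C>0}}}}}}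
  , trans (ℚₚ.*-assoc δ C⁻¹ C)
      (trans (cong (δ ℚ.*_) (ℚₚ.*-inverseˡ C {{ℚₚ.pos⇒nonZero C {{C>0}}}})) (ℚₚ.*-identityʳ δ))
  where
  C>0 : ℚ.Positive C
  C>0 = ℚ.positive 0<C
  C⁻¹ : ℚ
  C⁻¹ = ℚ.1/_ C {{ℚₚ.pos⇒nonZero C {{C>0}}}}

*-mono-≤-nonNeg : ∀ {p q r s} → 0ℚ ℚ.≤ p → 0ℚ ℚ.≤ s → p ℚ.≤ q → r ℚ.≤ s → p ℚ.* r ℚ.≤ q ℚ.* s
*-mono-≤-nonNeg {p} {q} {r} {s} 0≤p 0≤s p≤q r≤s = ℚₚ.≤-trans
  (ℚₚ.*-monoˡ-≤-nonNeg p {{ℚ.nonNegative 0≤p}} r≤s)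
  (ℚₚ.*-monoʳ-≤-nonNeg s {{ℚ.nonNegative 0≤s}} p≤q)

-- x y = (x + η) y - η y, where x + η ≥ 0 and y ≥ -θ; the slacks η and θ are
-- chosen in this order so that each term costs at most δ/2.
0≤ℝ-* : ∀ {x y} → 0ℝ ≤ℝ x → 0ℝ ≤ℝ y → 0ℝ ≤ℝ x *ℝ y
0≤ℝ-* {x} {y} 0≤x 0≤y δ 0<δ with halve 0<δ
... | h , 0<h , refl =
  let B , 0<B , b = eventually-bounded x
      C , 0<C , c = eventually-bounded y
      η , 0<η , ηC≡ = divide C 0<C h 0<h
      θ , 0<θ , θD≡ = divide (B ℚ.+ η) (ℚₚ.+-mono-< 0<B 0<η) h 0<h
  in eventually₂
    (λ n (|x|≤B , 0≤x+η) (|y|≤C , 0≤y+θ) → ≤-shift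
      (ℚₚ.+-mono-≤
        (ℚₚ.+-mono-≤
          (*-mono-≤-nonNeg (ℚₚ.≤-refl {0ℚ}) 0≤y+θ 0≤x+η 0≤y+θ)
          (*-mono-≤-nonNeg (ℚₚ.<⇒≤ 0<θ) (ℚₚ.<⇒≤ (ℚₚ.+-mono-< 0<B 0<η)) (ℚₚ.≤-refl {θ})
            (ℚₚ.+-monoˡ-≤ η (ℚₚ.≤-trans (p≤∣p∣ (seq x n)) |x|≤B))))
        (*-mono-≤-nonNeg (ℚₚ.<⇒≤ 0<η) (ℚₚ.<⇒≤ 0<C) (ℚₚ.≤-refl {η})
          (ℚₚ.≤-trans (p≤∣p∣ (seq y n)) |y|≤C)))
      (trans (cong₂ (λ u v → 0ℚ ℚ.+ ((seq x n ℚ.+ η) ℚ.* (seq y n ℚ.+ θ) ℚ.+ u ℚ.+ v)) θD≡ ηC≡)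
        (solve 5 (λ x y η θ h →
            con 0ℚ :+ ((x :+ η) :* (y :+ θ) :+ h :+ h)
              := x :* y :+ (h :+ h) :+ (con 0ℚ :* con 0ℚ :+ θ :* (x :+ η) :+ η :* y))
          refl (seq x n) (seq y n) η θ h)))
    (eventually₂ (λ _ → _,_) b (0≤x η 0<η))
    (eventually₂ (λ _ → _,_) c (0≤y θ 0<θ))

-- Factoring x² - y² as (x - y)(x + y) leaves a second factor eventually bounded by `B + C`, so `η`
-- is `δ / (B + C)`.
*ℝ-square-cong : ∀ {x y} → x ≈ℝ y → x *ℝ x ≈ℝ y *ℝ y
*ℝ-square-cong {x} {y} x≈y δ 0<δ =
  let B , 0<B , b = eventually-bounded x
      C , 0<C , c = eventually-bounded y
      η , 0<η , η*≡ = divide (B ℚ.+ C) (ℚₚ.+-mono-< 0<B 0<C) δ 0<δ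
  in eventually₂
    (λ n |x-y|≤η (|x|≤B , |y|≤C) → subst₂ ℚ._≤_
      (trans (sym (ℚₚ.∣p*q∣≡∣p∣*∣q∣ (seq x n ℚ.- seq y n) (seq x n ℚ.+ seq y n)))
        (cong ℚ.∣_∣ (solve 2 (λ x y → (x :- y) :* (x :+ y) := x :* x :- y :* y) refl
          (seq x n) (seq y n))))
      η*≡
      (*-mono-≤-nonNeg (ℚₚ.0≤∣p∣ _) (ℚₚ.<⇒≤ (ℚₚ.+-mono-< 0<B 0<C)) |x-y|≤η
        (ℚₚ.≤-trans (ℚₚ.∣p+q∣≤∣p∣+∣q∣ (seq x n) (seq y n)) (ℚₚ.+-mono-≤ |x|≤B |y|≤C))))
    (x≈y η 0<η) (eventually₂ (λ _ → _,_) b c)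

-- Natural numbers among the rationals and reals

ι : ℕ → ℚ
ι k = ℤ.+ k ℚ./ 1

-- Addition in ℚ normalises its result, so the identity is checked on unnormalised fractions with
-- denominator 1.
ι-+ : ∀ j k → ι (j + k) ≡ ι j ℚ.+ ι k
ι-+ j k = ℚₚ.toℚᵘ-injective (ℚᵘₚ.≃-trans (toℚᵘ-ι (j + k))
  (ℚᵘₚ.≃-sym (ℚᵘₚ.≃-trans (ℚₚ.toℚᵘ-homo-+ (ι j) (ι k))
    (ℚᵘₚ.≃-trans (ℚᵘₚ.+-cong (toℚᵘ-ι j) (toℚᵘ-ι k)) (ℚᵘ.*≡* (cong₂ ℤ._*_
      (cong₂ ℤ._+_ (ℤₚ.*-identityʳ (ℤ.+ j)) (ℤₚ.*-identityʳ (ℤ.+ k))) refl))))))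
  where
  toℚᵘ-ι : ∀ m → ℚ.toℚᵘ (ι m) ℚᵘ.≃ ℚᵘ.mkℚᵘ (ℤ.+ m) 0
  toℚᵘ-ι m = ℚₚ.toℚᵘ-fromℚᵘ (ℚᵘ.mkℚᵘ (ℤ.+ m) 0)

ι-pos : ∀ k → ℚ.Positive (ι (suc k))
ι-pos k = ℚₚ.normalize-pos (suc k) 1

ι-mono-< : ∀ k m → ι k ℚ.< ι (k + suc m)
ι-mono-< k m = subst₂ ℚ._<_ (ℚₚ.+-identityʳ (ι k)) (sym (ι-+ k (suc m)))
  (ℚₚ.+-monoʳ-< (ι k) (ℚₚ.positive⁻¹ (ι (suc m)) {{ι-pos m}}))

fromℚ-mono-< : ∀ {p q} → p ℚ.< q → fromℚ p <ℝ fromℚ q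
fromℚ-mono-< {p} {q} p<q = q ℚ.- p
  , subst (ℚ._< q ℚ.- p) (ℚₚ.+-inverseʳ p) (ℚₚ.+-monoˡ-< (ℚ.- p) p<q)
  , 0 , λ _ _ → ℚₚ.≤-reflexive (solve 2 (λ p q → p :+ (q :- p) := q) refl p q)

+-monoʳ-<ℝ : ∀ x {y z} → y <ℝ z → x +ℝ y <ℝ x +ℝ z
+-monoʳ-<ℝ x {y} {z} y<z = ≤-<ℝ-trans {x +ℝ y} {y +ℝ x} {x +ℝ z}
  (≈⇒≤ {x +ℝ y} {y +ℝ x} (+ℝ-comm x y))
  (<-≤ℝ-trans {y +ℝ x} {z +ℝ x} {x +ℝ z}
    (+-mono-<-≤ℝ {y} {z} {x} {x} y<z (≤ℝ-refl {x}))
    (≈⇒≤ {z +ℝ x} {x +ℝ z} (+ℝ-comm z x)))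

-- Sums over lists of natural numbers

Σℝ : (ℕ → ℝ) → List ℕ → ℝ
Σℝ g xs = foldr _+ℝ_ 0ℝ (map g xs)

Σℝ-↭ : ∀ g {xs ys} → xs ↭ ys → Σℝ g xs ≈ℝ Σℝ g ys
Σℝ-↭ g {xs} Perm.refl = ≈-refl {Σℝ g xs}
Σℝ-↭ g (Perm.prep {xs} {ys} x p) =
  +ℝ-cong {g x} {g x} {Σℝ g xs} {Σℝ g ys} (≈-refl {g x}) (Σℝ-↭ g p)
Σℝ-↭ g (Perm.swap {xs} {ys} x y p) =
  ≈-trans {Σℝ g (x ∷ y ∷ xs)} {Σℝ g (y ∷ x ∷ xs)} {Σℝ g (y ∷ x ∷ ys)}
    (pointwise {Σℝ g (x ∷ y ∷ xs)} {Σℝ g (y ∷ x ∷ xs)} λ n →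
      solve 3 (λ x y z → x :+ (y :+ z) := y :+ (x :+ z)) refl
        (seq (g x) n) (seq (g y) n) (seq (Σℝ g xs) n))
    (+ℝ-cong {g y} {g y} {Σℝ g (x ∷ xs)} {Σℝ g (x ∷ ys)} (≈-refl {g y})
      (+ℝ-cong {g x} {g x} {Σℝ g xs} {Σℝ g ys} (≈-refl {g x}) (Σℝ-↭ g p)))
Σℝ-↭ g (Perm.trans {xs} {ys} {zs} p q) =
  ≈-trans {Σℝ g xs} {Σℝ g ys} {Σℝ g zs} (Σℝ-↭ g p) (Σℝ-↭ g q)

-- An equality of terms, not merely `≈ℝ`, so that it can be combined with ring identities in ℚ.
Σℝ-replicate-++ : ∀ g k x ys n →
  seq (Σℝ g (replicate k x ++ ys)) n ≡ ι k ℚ.* seq (g x) n ℚ.+ seq (Σℝ g ys) n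
Σℝ-replicate-++ g zero x ys n =
  solve 2 (λ x y → y := con 0ℚ :* x :+ y) refl (seq (g x) n) (seq (Σℝ g ys) n)
Σℝ-replicate-++ g (suc k) x ys n = trans
  (cong (seq (g x) n ℚ.+_) (Σℝ-replicate-++ g k x ys n))
  (trans (solve 3 (λ k x y → x :+ (k :* x :+ y) := (con 1ℚ :+ k) :* x :+ y) refl
           (ι k) (seq (g x) n) (seq (Σℝ g ys) n))
    (cong (λ i → i ℚ.* seq (g x) n ℚ.+ seq (Σℝ g ys) n) (sym (ι-+ 1 k))))

Σℝ-replicate : ∀ g k x n → seq (Σℝ g (replicate k x)) n ≡ ι k ℚ.* seq (g x) n
Σℝ-replicate g k x n = trans
  (cong (λ xs → seq (Σℝ g xs) n) (sym (Listₚ.++-identityʳ (replicate k x))))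
  (trans (Σℝ-replicate-++ g k x [] n) (ℚₚ.+-identityʳ (ι k ℚ.* seq (g x) n)))

Σℝ-∷∷ : ∀ g x y xs → Σℝ g (x ∷ y ∷ xs) ≈ℝ (g x +ℝ g y) +ℝ Σℝ g xs
Σℝ-∷∷ g x y xs = pointwise {Σℝ g (x ∷ y ∷ xs)} {(g x +ℝ g y) +ℝ Σℝ g xs} λ n →
  sym (ℚₚ.+-assoc (seq (g x) n) (seq (g y) n) (seq (Σℝ g xs) n))

module _ (g : ℕ → ℝ) {x y z w : ℕ} (xs : List ℕ) where

  private
    before after : ℝ
    before = (g x +ℝ g y) +ℝ Σℝ g xs
    after  = (g z +ℝ g w) +ℝ Σℝ g xs

    before≤ : Σℝ g (x ∷ y ∷ xs) ≤ℝ before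
    before≤ = ≈⇒≤ {Σℝ g (x ∷ y ∷ xs)} {before} (Σℝ-∷∷ g x y xs)

    after≤ : after ≤ℝ Σℝ g (z ∷ w ∷ xs)
    after≤ = ≈⇒≤ {after} {Σℝ g (z ∷ w ∷ xs)}
      (≈-sym {Σℝ g (z ∷ w ∷ xs)} {after} (Σℝ-∷∷ g z w xs))

  Σℝ-∷∷-≤ : g x +ℝ g y ≤ℝ g z +ℝ g w → Σℝ g (x ∷ y ∷ xs) ≤ℝ Σℝ g (z ∷ w ∷ xs)
  Σℝ-∷∷-≤ le = ≤ℝ-trans {Σℝ g (x ∷ y ∷ xs)} {before} {Σℝ g (z ∷ w ∷ xs)} before≤
    (≤ℝ-trans {before} {after} {Σℝ g (z ∷ w ∷ xs)}
      (+-mono-≤ℝ {g x +ℝ g y} {g z +ℝ g w} {Σℝ g xs} {Σℝ g xs} le (≤ℝ-refl {Σℝ g xs})) after≤)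

  Σℝ-∷∷-< : g x +ℝ g y <ℝ g z +ℝ g w → Σℝ g (x ∷ y ∷ xs) <ℝ Σℝ g (z ∷ w ∷ xs)
  Σℝ-∷∷-< lt = ≤-<ℝ-trans {Σℝ g (x ∷ y ∷ xs)} {before} {Σℝ g (z ∷ w ∷ xs)} before≤
    (<-≤ℝ-trans {before} {after} {Σℝ g (z ∷ w ∷ xs)}
      (+-mono-<-≤ℝ {g x +ℝ g y} {g z +ℝ g w} {Σℝ g xs} {Σℝ g xs} lt (≤ℝ-refl {Σℝ g xs})) after≤)

-- Convexity on the natural numbers

-- The inner and the outer pair have the same sum. The successors keep both gaps positive; with a
-- zero gap the pairs would coincide up to order and the strict inequality would fail.
Convexℕ StrictlyConvexℕ : (ℕ → ℝ) → Set
Convexℕ g = ∀ a s t →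
  g (a + suc s) +ℝ g (a + suc t) ≤ℝ g a +ℝ g (a + suc s + suc t)
StrictlyConvexℕ g = ∀ a s t →
  g (a + suc s) +ℝ g (a + suc t) <ℝ g a +ℝ g (a + suc s + suc t)

-- Degrees are at least 1; shifting them by one turns the restriction of f
-- into a function on all of ℕ.
shifted : RealFunction → ℕ → ℝ
shifted f k = f ⟨$⟩ point (suc k) (s≤s z≤n)

combination : ℚ → ℝ → ℝ → ℝ
combination τ x y = fromℚ τ *ℝ x +ℝ (1ℝ -ℝ fromℚ τ) *ℝ y

module Interpolation (a s t : ℕ) where

  private
    ιa ιs ιt L : ℚ
    ιa = ι (suc a)
    ιs = ι (suc s)
    ιt = ι (suc t)
    L = ιs ℚ.+ ιt

    instance
      ιs>0 : ℚ.Positive ιs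
      ιs>0 = ι-pos s
      ιt>0 : ℚ.Positive ιt
      ιt>0 = ι-pos t
      L>0 : ℚ.Positive L
      L>0 = ℚₚ.pos+pos⇒pos ιs ιt

    L⁻¹ : ℚ
    L⁻¹ = ℚ.1/_ L {{ℚₚ.pos⇒nonZero L}}

    instance
      L⁻¹>0 : ℚ.Positive L⁻¹
      L⁻¹>0 = ℚₚ.1/pos⇒pos L

    L⁻¹*L≡1 : L⁻¹ ℚ.* L ≡ 1ℚ
    L⁻¹*L≡1 = ℚₚ.*-inverseˡ L {{ℚₚ.pos⇒nonZero L}}

  low high mid₁ mid₂ : ℕ
  low  = suc a
  mid₁ = suc (a + suc s)
  mid₂ = suc (a + suc t)
  high = suc (a + suc s + suc t)

  -- The weights of `low` in `mid₁` and `mid₂`, each the distance to `high` divided by `L`. Defining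
  -- `σ` as `1 - τ` makes `weights-cancel` a polynomial identity; `σ≡` recovers the quotient form.
  τ σ : ℚ
  τ = ιt ℚ.* L⁻¹
  σ = 1ℚ ℚ.- τ

  private
    σ≡ : ιs ℚ.* L⁻¹ ≡ σ
    σ≡ = trans (solve 3 (λ s t l → s :* l := l :* (s :+ t) :- t :* l) refl ιs ιt L⁻¹)
               (cong (ℚ._- τ) L⁻¹*L≡1)

    ι-high : ι high ≡ ιa ℚ.+ ιs ℚ.+ ιt
    ι-high = trans (ι-+ mid₁ (suc t)) (cong (ℚ._+ ιt) (ι-+ low (suc s)))

  0<τ : 0ℚ ℚ.< τ
  0<τ = ℚₚ.positive⁻¹ τ {{ℚₚ.pos*pos⇒pos ιt L⁻¹}}

  0<σ : 0ℚ ℚ.< σ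
  0<σ = subst (0ℚ ℚ.<_) σ≡ (ℚₚ.positive⁻¹ (ιs ℚ.* L⁻¹) {{ℚₚ.pos*pos⇒pos ιs L⁻¹}})

  τ<1 : τ ℚ.< 1ℚ
  τ<1 = subst₂ ℚ._<_ (ℚₚ.+-identityʳ τ) (solve 1 (λ t → t :+ (con 1ℚ :- t) := con 1ℚ) refl τ)
    (ℚₚ.+-monoʳ-< τ 0<σ)

  σ<1 : σ ℚ.< 1ℚ
  σ<1 = subst₂ ℚ._<_ (ℚₚ.+-identityʳ σ) (solve 1 (λ t → (con 1ℚ :- t) :+ t := con 1ℚ) refl τ)
    (ℚₚ.+-monoʳ-< σ 0<τ)

  private
    -- The ring solver cannot use that `L⁻¹` inverts `L`. Adding a multiple of `1 - L⁻¹ L`, which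
    -- vanishes, turns the interpolation formulas into polynomial identities.
    clear : ∀ c d → c ℚ.+ d ℚ.* (1ℚ ℚ.- L⁻¹ ℚ.* L) ≡ c
    clear c d = trans (cong (λ e → c ℚ.+ d ℚ.* (1ℚ ℚ.- e)) L⁻¹*L≡1)
      (solve 2 (λ c d → c :+ d :* (con 1ℚ :- con 1ℚ) := c) refl c d)

  mid₁-between : fromℕ mid₁ ≈ℝ combination τ (fromℕ low) (fromℕ high)
  mid₁-between = pointwise {fromℕ mid₁} {combination τ (fromℕ low) (fromℕ high)} λ _ →
    trans (ι-+ low (suc s)) (trans (sym (clear (ιa ℚ.+ ιs) ιt)) (trans
      (solve 4 (λ a s t l → a :+ s :+ t :* (con 1ℚ :- l :* (s :+ t))
                  := t :* l :* a :+ (con 1ℚ :- t :* l) :* (a :+ s :+ t)) refl ιa ιs ιt L⁻¹)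
      (cong (λ h → τ ℚ.* ιa ℚ.+ σ ℚ.* h) (sym ι-high))))

  mid₂-between : fromℕ mid₂ ≈ℝ combination σ (fromℕ low) (fromℕ high)
  mid₂-between = pointwise {fromℕ mid₂} {combination σ (fromℕ low) (fromℕ high)} λ _ →
    trans (ι-+ low (suc t)) (trans (sym (clear (ιa ℚ.+ ιt) (ℚ.- ιt))) (trans
      (solve 4 (λ a s t l → a :+ t :+ (:- t) :* (con 1ℚ :- l :* (s :+ t))
                  := (con 1ℚ :- t :* l) :* a
                     :+ (con 1ℚ :- (con 1ℚ :- t :* l)) :* (a :+ s :+ t)) refl ιa ιs ιt L⁻¹)
      (cong (λ h → σ ℚ.* ιa ℚ.+ (1ℚ ℚ.- σ) ℚ.* h) (sym ι-high))))

  -- The weights of `x` are `τ` and `1 - τ`, those of `y` the reverse, so adding the two convexity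
  -- inequalities leaves `x + y`.
  weights-cancel : ∀ x y → combination τ x y +ℝ combination σ x y ≈ℝ x +ℝ y
  weights-cancel x y = pointwise {combination τ x y +ℝ combination σ x y} {x +ℝ y} λ n →
    solve 3 (λ t x y →
        (t :* x :+ (con 1ℚ :- t) :* y) :+ ((con 1ℚ :- t) :* x :+ (con 1ℚ :- (con 1ℚ :- t)) :* y)
          := x :+ y)
      refl τ (seq x n) (seq y n)

module _ (f : RealFunction) (a s t : ℕ) where

  private
    open module P = Interpolation a s t
    g : ℕ → ℝ
    g = shifted f
    pt : ℕ → [1,∞⟩
    pt k = point (suc k) (s≤s z≤n)
    x y z₁ z₂ : ℝ
    x  = g a
    y  = g (a + suc s + suc t)
    z₁ = g (a + suc s)
    z₂ = g (a + suc t)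

  convex⇒spread-≤ : Convex f → z₁ +ℝ z₂ ≤ℝ x +ℝ y
  convex⇒spread-≤ cvx = ≤ℝ-trans {z₁ +ℝ z₂} {combination τ x y +ℝ combination σ x y} {x +ℝ y}
    (+-mono-≤ℝ {z₁} {combination τ x y} {z₂} {combination σ x y}
      (cvx (pt _) (pt _) (pt (a + suc s)) (fromℚ τ)
        (<⇒≤ℝ {0ℝ} {fromℚ τ} (fromℚ-mono-< 0<τ)) (<⇒≤ℝ {fromℚ τ} {1ℝ} (fromℚ-mono-< τ<1))
        mid₁-between)
      (cvx (pt _) (pt _) (pt (a + suc t)) (fromℚ σ)
        (<⇒≤ℝ {0ℝ} {fromℚ σ} (fromℚ-mono-< 0<σ)) (<⇒≤ℝ {fromℚ σ} {1ℝ} (fromℚ-mono-< σ<1))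
        mid₂-between))
    (≈⇒≤ {combination τ x y +ℝ combination σ x y} {x +ℝ y} (weights-cancel x y))

  strictlyConvex⇒spread-< : StrictlyConvex f → z₁ +ℝ z₂ <ℝ x +ℝ y
  strictlyConvex⇒spread-< cvx = <-≤ℝ-trans
    {z₁ +ℝ z₂} {combination τ x y +ℝ combination σ x y} {x +ℝ y}
    (+-mono-<-≤ℝ {z₁} {combination τ x y} {z₂} {combination σ x y}
      (cvx (pt _) (pt _) (pt (a + suc s)) (fromℚ τ) low<high
        (fromℚ-mono-< 0<τ) (fromℚ-mono-< τ<1) mid₁-between)
      (<⇒≤ℝ {z₂} {combination σ x y}
        (cvx (pt _) (pt _) (pt (a + suc t)) (fromℚ σ) low<high
          (fromℚ-mono-< 0<σ) (fromℚ-mono-< σ<1) mid₂-between)))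
    (≈⇒≤ {combination τ x y +ℝ combination σ x y} {x +ℝ y} (weights-cancel x y))
    where
    low<high : fromℕ low <ℝ fromℕ high
    low<high = fromℚ-mono-< (ℚₚ.<-trans (ι-mono-< low s) (ι-mono-< mid₁ t))

convex⇒convexℕ : ∀ f → Convex f → Convexℕ (shifted f)
convex⇒convexℕ f cvx a s t = convex⇒spread-≤ f a s t cvx

strictlyConvex⇒strictlyConvexℕ : ∀ f → StrictlyConvex f → StrictlyConvexℕ (shifted f)
strictlyConvex⇒strictlyConvexℕ f cvx a s t = strictlyConvex⇒spread-< f a s t cvx

-- The square as a test function

square : RealFunction
square = record
  { to   = λ x → proj₁ x *ℝ proj₁ x
  ; cong = λ {x} {y} → *ℝ-square-cong {proj₁ x} {proj₁ y}
  }

0≤p*p : ∀ p → 0ℚ ℚ.≤ p ℚ.* p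
0≤p*p p@(ℚ.mkℚ (ℤ.+ _) _ _)    = ℚₚ.nonNegative⁻¹ (p ℚ.* p) {{ℚₚ.nonNeg*nonNeg⇒nonNeg p p}}
0≤p*p p@(ℚ.mkℚ ℤ.-[1+ _ ] _ _) = ℚₚ.nonNegative⁻¹ (p ℚ.* p) {{ℚₚ.nonPos*nonPos⇒nonPos p p}}

≤-from-gap : ∀ {x y d} → 0ℝ ≤ℝ d → (∀ n → seq x n ℚ.+ seq d n ≡ seq y n) → x ≤ℝ y
≤-from-gap {x} {y} {d} 0≤d eq δ 0<δ with 0≤d δ 0<δ
... | N , p = N , λ n le → ≤-shift (p n le)
  (trans (solve 3 (λ x d δ → x :+ (d :+ δ) := x :+ d :+ δ :+ con 0ℚ) refl (seq x n) (seq d n) δ)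
    (cong (λ e → e ℚ.+ δ ℚ.+ 0ℚ) (eq n)))

-- Once `z` is replaced by the combination `w`, the two sides differ by t (1 - t) (x - y)², a
-- product of nonnegative factors.
square-convex : Convex square
square-convex (x , _) (y , _) (z , _) t 0≤t t≤1 z≈ =
  ≤ℝ-trans {z *ℝ z} {w *ℝ w} {t *ℝ (x *ℝ x) +ℝ (1ℝ -ℝ t) *ℝ (y *ℝ y)}
    (≈⇒≤ {z *ℝ z} {w *ℝ w} (*ℝ-square-cong {z} {w} z≈))
    (≤-from-gap {w *ℝ w} {t *ℝ (x *ℝ x) +ℝ (1ℝ -ℝ t) *ℝ (y *ℝ y)}
      {t *ℝ (1ℝ -ℝ t) *ℝ ((x -ℝ y) *ℝ (x -ℝ y))}
      (0≤ℝ-* {t *ℝ (1ℝ -ℝ t)} {(x -ℝ y) *ℝ (x -ℝ y)}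
        (0≤ℝ-* {t} {1ℝ -ℝ t} 0≤t 0≤1-t)
        (pointwise-≤ {0ℝ} {(x -ℝ y) *ℝ (x -ℝ y)} λ n → 0≤p*p (seq x n ℚ.- seq y n)))
      λ n → solve 3 (λ t x y →
          (t :* x :+ (con 1ℚ :- t) :* y) :* (t :* x :+ (con 1ℚ :- t) :* y)
            :+ t :* (con 1ℚ :- t) :* ((x :- y) :* (x :- y))
          := t :* (x :* x) :+ (con 1ℚ :- t) :* (y :* y))
        refl (seq t n) (seq x n) (seq y n))
  where
  w : ℝ
  w = t *ℝ x +ℝ (1ℝ -ℝ t) *ℝ y
  0≤1-t : 0ℝ ≤ℝ 1ℝ -ℝ t
  0≤1-t δ 0<δ with t≤1 δ 0<δ
  ... | N , p = N , λ n le → ≤-shift (p n le)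
    (solve 2 (λ t δ → con 0ℚ :+ (con 1ℚ :+ δ) := con 1ℚ :- t :+ δ :+ t) refl (seq t n) δ)

-- The two sides differ by the constant 2 (s + 1) (t + 1). Through this one function, attainment for
-- all convex functions already determines the degree sequence.
square-strictlyConvexℕ : StrictlyConvexℕ (shifted square)
square-strictlyConvexℕ a s t = ιs ℚ.* ιt ℚ.+ ιs ℚ.* ιt
  , ℚₚ.+-mono-< 0<st 0<st
  , 0 , λ _ _ → ℚₚ.≤-reflexive (trans
      (cong₂ (λ b c → b ℚ.* b ℚ.+ c ℚ.* c ℚ.+ (ιs ℚ.* ιt ℚ.+ ιs ℚ.* ιt))
        (ι-+ (suc a) (suc s)) (ι-+ (suc a) (suc t)))
      (trans (solve 3 (λ a s t →
          (a :+ s) :* (a :+ s) :+ (a :+ t) :* (a :+ t) :+ (s :* t :+ s :* t)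
            := a :* a :+ (a :+ s :+ t) :* (a :+ s :+ t)) refl ιa ιs ιt)
        (cong (λ h → ιa ℚ.* ιa ℚ.+ h ℚ.* h)
          (sym (trans (ι-+ (suc (a + suc s)) (suc t)) (cong (ℚ._+ ιt) (ι-+ (suc a) (suc s))))))))
  where
  ιa ιs ιt : ℚ
  ιa = ι (suc a)
  ιs = ι (suc s)
  ιt = ι (suc t)
  0<st : 0ℚ ℚ.< ιs ℚ.* ιt
  0<st = ℚₚ.positive⁻¹ (ιs ℚ.* ιt) {{ℚₚ.pos*pos⇒pos ιs {{ι-pos s}} ιt {{ι-pos t}}}}

-- Majorisation

infix 4 _⊑_
infixr 5 _then_

data _⊑_ : List ℕ → List ℕ → Set where
  perm   : ∀ {xs ys} → xs ↭ ys → xs ⊑ ys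
  spread : ∀ a s t xs → (a + suc s) ∷ (a + suc t) ∷ xs ⊑ a ∷ (a + suc s + suc t) ∷ xs
  cons   : ∀ x {xs ys} → xs ⊑ ys → x ∷ xs ⊑ x ∷ ys
  _then_ : ∀ {xs ys zs} → xs ⊑ ys → ys ⊑ zs → xs ⊑ zs

⊑-sum : ∀ {xs ys} → xs ⊑ ys → sum xs ≡ sum ys
⊑-sum (perm p)          = sum-↭ p
⊑-sum (spread a s t xs) = regroup a (suc s) (suc t) (sum xs)
  where
  regroup : ∀ a s t u → a + s + (a + t + u) ≡ a + (a + s + t + u)
  regroup = solve-∀
⊑-sum (cons x p)        = cong (x +_) (⊑-sum p)
⊑-sum (p then q)        = trans (⊑-sum p) (⊑-sum q)

⊑-length : ∀ {xs ys} → xs ⊑ ys → length xs ≡ length ys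
⊑-length (perm p)          = ↭-length p
⊑-length (spread a s t xs) = refl
⊑-length (cons x p)        = cong suc (⊑-length p)
⊑-length (p then q)        = trans (⊑-length p) (⊑-length q)

⊑-convex : ∀ {g xs ys} → Convexℕ g → xs ⊑ ys → Σℝ g xs ≤ℝ Σℝ g ys
⊑-convex {g} {xs} {ys} cvx (perm p) = ≈⇒≤ {Σℝ g xs} {Σℝ g ys} (Σℝ-↭ g p)
⊑-convex {g} cvx (spread a s t xs) = Σℝ-∷∷-≤ g xs (cvx a s t)
⊑-convex {g} cvx (cons x {xs} {ys} p) =
  +-mono-≤ℝ {g x} {g x} {Σℝ g xs} {Σℝ g ys} (≤ℝ-refl {g x}) (⊑-convex cvx p)
⊑-convex {g} cvx (_then_ {xs} {ys} {zs} p q) =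
  ≤ℝ-trans {Σℝ g xs} {Σℝ g ys} {Σℝ g zs} (⊑-convex cvx p) (⊑-convex cvx q)

-- Each `spread` gains strictly, so a derivation without gain consists of rearrangements only. The
-- alternative is read off the derivation, which avoids deciding an order between real numbers.
⊑-strictlyConvex : ∀ {g xs ys} → StrictlyConvexℕ g → xs ⊑ ys → xs ↭ ys ⊎ Σℝ g xs <ℝ Σℝ g ys
⊑-strictlyConvex cvx (perm p) = inj₁ p
⊑-strictlyConvex {g} cvx (spread a s t xs) = inj₂ (Σℝ-∷∷-< g xs (cvx a s t))
⊑-strictlyConvex {g} cvx (cons x {xs} {ys} p) =
  Sum.map (Perm.prep x) (+-monoʳ-<ℝ (g x) {Σℝ g xs} {Σℝ g ys}) (⊑-strictlyConvex {g} cvx p)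
⊑-strictlyConvex {g} cvx (_then_ {xs} {ys} {zs} p q)
  with ⊑-strictlyConvex {g} cvx p | ⊑-strictlyConvex {g} cvx q
... | inj₁ eq | inj₁ eq′ = inj₁ (Perm.trans eq eq′)
... | inj₁ eq | inj₂ lt  = inj₂ (≤-<ℝ-trans {Σℝ g xs} {Σℝ g ys} {Σℝ g zs}
  (≈⇒≤ {Σℝ g xs} {Σℝ g ys} (Σℝ-↭ g eq)) lt)
... | inj₂ lt | inj₁ eq  = inj₂ (<-≤ℝ-trans {Σℝ g xs} {Σℝ g ys} {Σℝ g zs} lt
  (≈⇒≤ {Σℝ g ys} {Σℝ g zs} (Σℝ-↭ g eq)))
... | inj₂ lt | inj₂ lt′ = inj₂ (<-≤ℝ-trans {Σℝ g xs} {Σℝ g ys} {Σℝ g zs} lt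
  (<⇒≤ℝ {Σℝ g ys} {Σℝ g zs} lt′))

-- Moves towards the extremal sequences

spread-to : ∀ {a b x y} xs → a ≤ x → a ≤ y → a + b ≡ x + y → x ∷ y ∷ xs ⊑ a ∷ b ∷ xs
spread-to {a} {b} {x} {y} xs a≤x a≤y eq =
  subst₂ (λ x y → x ∷ y ∷ xs ⊑ a ∷ b ∷ xs) (ℕₚ.m+[n∸m]≡n a≤x) (ℕₚ.m+[n∸m]≡n a≤y)
    (subst (λ b → (a + (x ∸ a)) ∷ (a + (y ∸ a)) ∷ xs ⊑ a ∷ b ∷ xs)
      (ℕₚ.+-cancelˡ-≡ a _ _ (trans
        (trans (regroup a (x ∸ a) (y ∸ a))
          (cong₂ _+_ (ℕₚ.m+[n∸m]≡n a≤x) (ℕₚ.m+[n∸m]≡n a≤y)))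
        (sym eq)))
      (go (x ∸ a) (y ∸ a)))
  where
  regroup : ∀ a s t → a + (a + s + t) ≡ a + s + (a + t)
  regroup = solve-∀
  go : ∀ s t → (a + s) ∷ (a + t) ∷ xs ⊑ a ∷ (a + s + t) ∷ xs
  -- If one of the gaps above `a` is zero, the move is only a rearrangement.
  go zero t rewrite ℕₚ.+-identityʳ a = perm Perm.refl
  go (suc s) zero rewrite ℕₚ.+-identityʳ a | ℕₚ.+-identityʳ (a + suc s) =
    perm (Perm.swap _ _ Perm.refl)
  go (suc s) (suc t) = spread a s t xs

m+n∸o≤m : ∀ m {n o} → n ≤ o → m + n ∸ o ≤ m
m+n∸o≤m m {n} n≤o = ≤-trans (ℕₚ.∸-monoʳ-≤ (m + n) n≤o) (ℕₚ.≤-reflexive (ℕₚ.m+n∸n≡m m n))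

-- Greedy filling: r is a single partially filled entry, which absorbs the next
-- entry x if r + x ≤ D and is topped up to D otherwise.
fill : ∀ {D} r xs → r ≤ D → All (_≤ D) xs →
  ∃[ r′ ] ∃[ q ] ∃[ c ] (r′ ≤ D × r ∷ xs ⊑ r′ ∷ replicate q D ++ replicate c 0)
fill r [] r≤D [] = r , 0 , 0 , r≤D , perm Perm.refl
fill {D} r (x ∷ xs) r≤D (x≤D ∷ xs≤D) with ℕₚ.≤-total (r + x) D
... | inj₁ r+x≤D =
  let r′ , q , c , r′≤D , p = fill (r + x) xs r+x≤D xs≤D
  in r′ , q , suc c , r′≤D ,
     (spread-to xs z≤n z≤n refl then cons 0 p then
      perm (Perm.trans (Perm.swap 0 r′ Perm.refl)
        (Perm.prep r′ (↭-sym (shift 0 (replicate q D) (replicate c 0))))))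
... | inj₂ D≤r+x =
  let r′ , q , c , r′≤D , p = fill (r + x ∸ D) xs (≤-trans (m+n∸o≤m r x≤D) r≤D) xs≤D
  in r′ , suc q , c , r′≤D ,
     -- The pair `r`, `x` moves apart to `r + x ∸ D` and `D`; the former is at most `r` because
     -- `x ≤ D`, and at most `x` because `r ≤ D`.
     (spread-to xs (m+n∸o≤m r x≤D)
        (subst (λ s → s ∸ D ≤ x) (ℕₚ.+-comm x r) (m+n∸o≤m x r≤D)) (ℕₚ.m∸n+n≡m D≤r+x) then
      perm (Perm.swap _ _ Perm.refl) then cons D p then perm (Perm.swap D r′ Perm.refl))

sum-replicate : ∀ k x → sum (replicate k x) ≡ k * x
sum-replicate zero    x = refl
sum-replicate (suc k) x = cong (x +_) (sum-replicate k x)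

[r+q*D]/D≡q : ∀ {r D} q .{{_ : NonZero D}} → r < D → (r + q * D) / D ≡ q
[r+q*D]/D≡q {r} {D} q r<D = trans (DivMod.+-distrib-/-∣ʳ r (divides q refl))
  (cong₂ _+_ (DivMod.m<n⇒m/n≡0 r<D) (DivMod.m*n/n≡m q D))

-- Length and sum are invariant under `⊑`, so the result of `fill` satisfies `n = r + q * D` and
-- `n = c + (q + 1)`. These equations identify `q` and `r` by division with remainder, except when
-- `r` equals `D`.
⊑-greedy : ∀ {n D} xs .{{_ : NonZero D}} → 2 ≤ D → 1 ≤ n →
  length xs ≡ n → sum xs ≡ n → All (_≤ D) xs →
  let q = n / D in xs ⊑ replicate q D ++ (n ∸ q * D) ∷ replicate (n ∸ (q + 1)) 0
⊑-greedy [] 2≤D () refl _ _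
⊑-greedy {n} {D} (x ∷ xs) 2≤D 1≤n len sm (x≤D ∷ xs≤D) with fill x xs x≤D xs≤D
... | r , q , c , r≤D , p = go (ℕₚ.m≤n⇒m<n∨m≡n r≤D)
  where
  n≡len : n ≡ c + (q + 1)
  n≡len = trans (sym len) (trans (⊑-length p)
    (trans (cong suc (trans (Listₚ.length-++ (replicate q D))
      (cong₂ _+_ (Listₚ.length-replicate q) (Listₚ.length-replicate c)))) (regroup q c)))
    where
    regroup : ∀ q c → suc (q + c) ≡ c + (q + 1)
    regroup = solve-∀
  n≡sum : n ≡ r + q * D
  n≡sum = trans (sym sm) (trans (⊑-sum p) (cong (r +_)
    (trans (sum-++ (replicate q D) (replicate c 0))
      (trans (cong₂ _+_ (sum-replicate q D) (trans (sum-replicate c 0) (ℕₚ.*-zeroʳ c)))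
        (ℕₚ.+-identityʳ (q * D))))))

  go : r < D ⊎ r ≡ D →
       x ∷ xs ⊑ replicate (n / D) D ++ (n ∸ n / D * D) ∷ replicate (n ∸ (n / D + 1)) 0
  go (inj₁ r<D) = subst (x ∷ xs ⊑_) shape
    (p then perm (↭-sym (shift r (replicate q D) (replicate c 0))))
    where
    q≡ : n / D ≡ q
    q≡ = trans (cong (_/ D) n≡sum) ([r+q*D]/D≡q q r<D)
    shape : replicate q D ++ r ∷ replicate c 0 ≡
            replicate (n / D) D ++ (n ∸ n / D * D) ∷ replicate (n ∸ (n / D + 1)) 0
    shape rewrite q≡ = cong₂ (λ r c → replicate q D ++ r ∷ replicate c 0)
      (sym (trans (cong (_∸ q * D) n≡sum) (ℕₚ.m+n∸n≡m r (q * D))))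
      (sym (trans (cong (_∸ (q + 1)) n≡len) (ℕₚ.m+n∸n≡m c (q + 1))))
  -- A full `r` joins the block of entries `D`: the quotient becomes `suc q`, the remainder 0, and
  -- one of the `c` zeros takes the place of the remainder.
  go (inj₂ refl) = subst (x ∷ xs ⊑_) (shape c n≡len) p
    where
    q≡ : n / D ≡ suc q
    q≡ = trans (cong (_/ D) n≡sum) (DivMod.m*n/n≡m (suc q) D)
    -- Such a zero exists because `2 ≤ D` gives `suc q < suc q * D = n`.
    q+1<n : suc q < n
    q+1<n = subst₂ _<_ (ℕₚ.*-identityʳ (suc q)) (sym n≡sum) (ℕₚ.*-monoʳ-< (suc q) 2≤D)
    shape : ∀ c → n ≡ c + (q + 1) → D ∷ replicate q D ++ replicate c 0 ≡
            replicate (n / D) D ++ (n ∸ n / D * D) ∷ replicate (n ∸ (n / D + 1)) 0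
    shape zero eq with () ← ℕₚ.<-irrefl (trans (ℕₚ.+-comm 1 q) (sym eq)) q+1<n
    shape (suc c) eq rewrite q≡ = cong₂ (λ r c → D ∷ replicate q D ++ r ∷ replicate c 0)
      (sym (trans (cong (_∸ suc q * D) n≡sum) (ℕₚ.n∸n≡0 (suc q * D))))
      (sym (trans (cong (_∸ suc (q + 1)) eq) (ℕₚ.m+n∸n≡m c (q + 1))))

-- The leading entry absorbs the others one at a time, each move leaving a 0 behind.
⊑-collapse : ∀ x xs → x ∷ xs ⊑ (x + sum xs) ∷ replicate (length xs) 0
⊑-collapse x [] rewrite ℕₚ.+-identityʳ x = perm Perm.refl
⊑-collapse x (y ∷ xs) = spread-to xs z≤n z≤n refl then
  subst (λ s → 0 ∷ (x + y) ∷ xs ⊑ 0 ∷ s ∷ replicate (length xs) 0) (ℕₚ.+-assoc x y (sum xs))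
    (cons 0 (⊑-collapse (x + y) xs))
  then perm (Perm.swap _ _ Perm.refl)

-- With `x` fixed, the other two heavy entries move apart to `1` and `suc a + b`, and the latter
-- absorbs the rest of the list. The sum `n` forces its final value to be `n ∸ suc x`, and this
-- value is positive.
⊑-three-heavy : ∀ {n x a b} xs →
  length (x ∷ suc a ∷ suc b ∷ xs) ≡ n → sum (x ∷ suc a ∷ suc b ∷ xs) ≡ n →
  suc x < n × (x ∷ suc a ∷ suc b ∷ xs ⊑ x ∷ (n ∸ suc x) ∷ 1 ∷ replicate (n ∸ 3) 0)
⊑-three-heavy {n} {x} {a} {b} xs refl sm =
    subst (suc x <_) total (ℕₚ.m<n+m (suc x) (s≤s z≤n))
  , subst (λ m → x ∷ suc a ∷ suc b ∷ xs ⊑ x ∷ m ∷ 1 ∷ replicate (length xs) 0) m≡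
      (cons x (spread-to xs (s≤s z≤n) (s≤s z≤n) (sym (cong suc (ℕₚ.+-suc a b)))
        then cons 1 (⊑-collapse (suc a + b) xs)
        then perm (Perm.swap _ _ Perm.refl)))
  where
  m = suc a + b + sum xs
  regroup : ∀ x a b s → suc (a + b + s) + suc x ≡ x + (suc a + (suc b + s))
  regroup = solve-∀
  total : m + suc x ≡ n
  total = trans (regroup x a b (sum xs)) sm
  m≡ : m ≡ n ∸ suc x
  m≡ = trans (sym (ℕₚ.m+n∸n≡m m (suc x))) (cong (_∸ suc x) total)

-- Paths and trees

lastOf : {A : Set} → A → List A → A
lastOf x []       = x
lastOf x (y ∷ ys) = lastOf y ys

module _ {A : Set} {R : A → A → Set} where

  linked-∷ʳ⁻ : ∀ {x} ys {z} → Linked R ((x ∷ ys) ∷ʳ z) → Linked R (x ∷ ys) × R (lastOf x ys) z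
  linked-∷ʳ⁻ []       (r ∷ _) = [-] , r
  linked-∷ʳ⁻ (y ∷ ys) (r ∷ l) = let l′ , e = linked-∷ʳ⁻ ys l in r ∷ l′ , e

  linked-lookup : ∀ xs {u v ys} → Linked R (xs ++ u ∷ v ∷ ys) → R u v
  linked-lookup []           (r ∷ _) = r
  linked-lookup (x ∷ [])     (_ ∷ l) = linked-lookup [] l
  linked-lookup (x ∷ y ∷ xs) (_ ∷ l) = linked-lookup (y ∷ xs) l

  linked-predecessor : ∀ {x y} ys → Linked R (x ∷ y ∷ ys) →
    ∃[ z ] (z ∈ x ∷ y ∷ ys × R z (lastOf y ys))
  linked-predecessor []       (r ∷ _) = _ , here refl , r
  linked-predecessor (_ ∷ ys) (_ ∷ l) =
    let z , z∈ , r = linked-predecessor ys l in z , there z∈ , r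

module _ {n : ℕ} (R : Fin n → Fin n → Set) where

  open import Data.List.Membership.DecPropositional (Finₚ._≟_ {n}) using (_∈?_)

  -- The list holds the vertices after the first one.
  data Walk : Fin n → Fin n → List (Fin n) → Set where
    nil  : ∀ {x} → Walk x x []
    cons : ∀ {x y z l} → R x y → Walk y z l → Walk x z (y ∷ l)

  SimplePath : Fin n → Fin n → Set
  SimplePath x y = ∃[ l ] (Walk x y l × Unique (x ∷ l))

  suffix-from : ∀ {x y z l} → Walk x y l → Unique (x ∷ l) → z ∈ x ∷ l → SimplePath z y
  suffix-from w          u       (here refl) = _ , w , u
  suffix-from (cons _ w) (_ ∷ u) (there z∈)  = suffix-from w u z∈

  -- When the new first vertex already occurs on the simple path, the path is cut at that
  -- occurrence.
  star⇒simplePath : ∀ {x y} → Star R x y → SimplePath x y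
  star⇒simplePath ε = [] , nil , [] ∷ []
  star⇒simplePath {x} (_◅_ {j = z} r s) with star⇒simplePath s
  ... | l , w , u with x ∈? z ∷ l
  ...   | yes x∈ = suffix-from w u x∈
  ...   | no  x∉ = z ∷ l , cons r w , Allₚ.¬Any⇒All¬ _ x∉ ∷ u

module _ {n : ℕ} {R : Fin n → Fin n → Set} where

  -- The closing step lies only in the weaker relation `S`: a path of oriented edges is to be closed
  -- by an edge of the graph that is not yet known to be oriented.
  walk-∷ʳ : ∀ {S : Fin n → Fin n → Set} → (∀ {u v} → R u v → S u v) →
            ∀ {x y z l} → Walk R x y l → S y z → Linked S ((x ∷ l) ∷ʳ z)
  walk-∷ʳ f nil        e = e ∷ [-]
  walk-∷ʳ f (cons r w) e = f r ∷ walk-∷ʳ f w e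

  walk-last : ∀ {x y l} z → Walk R x y l → ∃[ xs ] ((x ∷ l) ∷ʳ z ≡ xs ++ y ∷ z ∷ [])
  walk-last z nil        = [] , refl
  walk-last z (cons {x} _ w) = let xs , eq = walk-last z w in x ∷ xs , cong (x ∷_) eq

module Tree {n : ℕ} (G : Graph n) (root last : Fin n) where
  open Graph G

  -- The index lists the vertices reached so far.
  data Tree : List (Fin n) → Set where
    trivial : Tree (root ∷ [])
    attach  : ∀ {S} → Tree S → ∀ v w → v ∉ S → w ∈ S → Adj v w → Tree (v ∷ S)

  -- The root is assigned the vertex last, which closes up a cycle.
  parent : ∀ {S} → Tree S → Fin n → Fin n
  parent trivial              u = last
  parent (attach t v w _ _ _) u = if does (u Finₚ.≟ v) then w else parent t u

  parent-new : ∀ {S} (t : Tree S) {v w} v∉ w∈ e → parent (attach t v w v∉ w∈ e) v ≡ w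
  parent-new t {v} v∉ w∈ e rewrite dec-true (v Finₚ.≟ v) refl = refl

  parent-old : ∀ {S} (t : Tree S) {v w} v∉ w∈ e {u} → u ∈ S →
               parent (attach t v w v∉ w∈ e) u ≡ parent t u
  parent-old t {v} v∉ w∈ e {u} u∈ rewrite dec-false (u Finₚ.≟ v) (λ { refl → v∉ u∈ }) = refl

  root∈ : ∀ {S} → Tree S → root ∈ S
  root∈ trivial              = here refl
  root∈ (attach t _ _ _ _ _) = there (root∈ t)

  parent-root : ∀ {S} (t : Tree S) → parent t root ≡ last
  parent-root trivial                 = refl
  parent-root (attach t v w v∉ w∈ e) = trans (parent-old t v∉ w∈ e (root∈ t)) (parent-root t)

  parent-adj : ∀ {S} (t : Tree S) {u} → u ∈ S → u ≢ root → Adj u (parent t u) × parent t u ∈ S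
  parent-adj trivial (here refl) u≢ = ⊥-elim (u≢ refl)
  parent-adj (attach t v w v∉ w∈ e) (here refl) u≢ rewrite parent-new t v∉ w∈ e = e , there w∈
  parent-adj (attach t v w v∉ w∈ e) (there u∈) u≢ rewrite parent-old t v∉ w∈ e u∈ =
    let a , p∈ = parent-adj t u∈ u≢ in a , there p∈

  -- A newly attached vertex lies outside the earlier tree, which contains its grandparent. The root
  -- is excluded in both places because its parent `last` does not follow the order of attachment.
  parent-parent : ∀ {S} (t : Tree S) {u} → u ∈ S → u ≢ root → parent t u ≢ root →
                  parent t (parent t u) ≢ u
  parent-parent trivial (here refl) u≢ _ = ⊥-elim (u≢ refl)
  parent-parent (attach t v w v∉ w∈ e) (here refl) u≢ p≢
    rewrite parent-new t v∉ w∈ e | parent-old t v∉ w∈ e w∈ =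
    λ eq → v∉ (subst (_∈ _) eq (proj₂ (parent-adj t w∈ p≢)))
  parent-parent (attach t v w v∉ w∈ e) (there u∈) u≢ p≢
    rewrite parent-old t v∉ w∈ e u∈ | parent-old t v∉ w∈ e (proj₂ (parent-adj t u∈ u≢)) =
    parent-parent t u∈ u≢ p≢

  -- The map `p` stays fixed while the induction passes to smaller trees, whose parent maps it
  -- extends.
  to-root : ∀ {S} (t : Tree S) (p : Fin n → Fin n) → (∀ {u} → u ∈ S → p u ≡ parent t u) →
            ∀ {u} → u ∈ S → Star (λ a b → p a ≡ b) u root
  to-root trivial p p≡ (here refl) = ε
  to-root (attach t v w v∉ w∈ e) p p≡ (here refl) =
    trans (p≡ (here refl)) (parent-new t v∉ w∈ e)
      ◅ to-root t p (λ u∈ → trans (p≡ (there u∈)) (parent-old t v∉ w∈ e u∈)) w∈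
  to-root (attach t v w v∉ w∈ e) p p≡ (there u∈) =
    to-root t p (λ u∈ → trans (p≡ (there u∈)) (parent-old t v∉ w∈ e u∈)) u∈

  Extends : ∀ {S S′} → Tree S → Tree S′ → Set
  Extends {S} {S′} t t′ = ∀ {u} → u ∈ S → u ∈ S′ × parent t′ u ≡ parent t u

  extends-trans : ∀ {S S′ S″} (t : Tree S) (t′ : Tree S′) (t″ : Tree S″) →
                  Extends t t′ → Extends t′ t″ → Extends t t″
  extends-trans t t′ t″ e e′ u∈ =
    let u∈′ , eq = e u∈
        u∈″ , eq′ = e′ u∈′
    in u∈″ , trans eq′ eq

  attach-extends : ∀ {S} (t : Tree S) {v w} v∉ w∈ e → Extends t (attach t v w v∉ w∈ e)
  attach-extends t v∉ w∈ e u∈ = there u∈ , parent-old t v∉ w∈ e u∈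

  adj-sym : ∀ {u v} → Adj u v → Adj v u
  adj-sym {u} {v} = subst T (symmetric u v)

  -- Each vertex of `l` is attached to its predecessor, and the root has parent `last`. Hence the
  -- parent map runs through the cycle backwards.
  attach-path : ∀ {x S} (t : Tree (x ∷ S)) l → Linked Adj (x ∷ l) → Unique l →
    All (_∉ x ∷ S) l → lastOf x l ≡ last →
    ∃[ S′ ] Σ[ t′ ∈ Tree S′ ]
      (Extends t t′ × Linked (λ a b → b ∈ S′ × parent t′ b ≡ a) ((x ∷ l) ∷ʳ root))
  attach-path t [] _ _ _ x≡last =
    _ , t , (λ u∈ → u∈ , refl) , (root∈ t , trans (parent-root t) (sym x≡last)) ∷ [-]
  attach-path {x} {S} t (y ∷ l) (e ∷ es) (y∉l ∷ u) (y∉ ∷ l∉) eq =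
    let S′ , t′ , ext , linked = attach-path t₁ l es u (All.zipWith ∉-∷ (y∉l , l∉)) eq
        y∈ , y≡ = ext (here refl)
    in S′ , t′ , extends-trans t t₁ t′ (attach-extends t y∉ (here refl) (adj-sym e)) ext
       , (y∈ , trans y≡ (parent-new t y∉ (here refl) (adj-sym e))) ∷ linked
    where
    t₁ : Tree (y ∷ x ∷ S)
    t₁ = attach t y x y∉ (here refl) (adj-sym e)
    ∉-∷ : ∀ {v} → y ≢ v × v ∉ x ∷ S → v ∉ y ∷ x ∷ S
    ∉-∷ (y≢ , _)  (here refl) = y≢ refl
    ∉-∷ (_ , v∉) (there v∈)  = v∉ v∈

  open import Data.List.Membership.DecPropositional (Finₚ._≟_ {n}) using (_∈?_)

  -- The walk ends in the tree, so its second vertex is reached first and serves as the parent of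
  -- `u` if `u` is still missing.
  reach : ∀ {S} (t : Tree S) {u} → Star Adj u root →
          ∃[ S′ ] Σ[ t′ ∈ Tree S′ ] (Extends t t′ × u ∈ S′)
  reach t ε = _ , t , (λ u∈ → u∈ , refl) , root∈ t
  reach t {u} (_◅_ {j = w} e s) with reach t s
  ... | S′ , t′ , ext , w∈ with u ∈? S′
  ...   | yes u∈ = S′ , t′ , ext , u∈
  ...   | no  u∉ =
    _ , attach t′ u w u∉ w∈ e
      , extends-trans t t′ (attach t′ u w u∉ w∈ e) ext (attach-extends t′ u∉ w∈ e)
      , here refl

  reach-all : ∀ {S} (t : Tree S) us → ∃[ S′ ] Σ[ t′ ∈ Tree S′ ] (Extends t t′ × All (_∈ S′) us)
  reach-all t [] = _ , t , (λ u∈ → u∈ , refl) , []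
  reach-all t (u ∷ us) with reach t (connected u root)
  ... | S′ , t′ , ext , u∈ with reach-all t′ us
  ...   | S″ , t″ , ext′ , us∈ =
    S″ , t″ , extends-trans t t′ t″ ext ext′ , proj₁ (ext′ u∈) ∷ us∈

-- Orientations with all out-degrees 1

-- Every vertex has exactly one outgoing arc, to `next u`. By `covers` each edge is an arc in some
-- direction, and by `no-return` not in both.
record Orientation {n : ℕ} (G : Graph n) : Set where
  open Graph G
  field
    next      : Fin n → Fin n
    next-adj  : ∀ u → Adj u (next u)
    no-return : ∀ u → next (next u) ≢ u
    covers    : ∀ {u v} → Adj u v → next u ≡ v ⊎ next v ≡ u

unicyclic⇒orientation : ∀ {n} (G : Graph n) → Unicyclic G → Orientation G
unicyclic⇒orientation G (record { rest = [] ; long = s≤s () } , _)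
unicyclic⇒orientation G (record { rest = _ ∷ [] ; long = s≤s (s≤s ()) } , _)
unicyclic⇒orientation {n} G (c@(record
  { start = c₀ ; rest = c₁ ∷ c₂ ∷ cs ; distinct = c₀∉ ∷ unique ; closed = closed }) , c-unique)
  = record { next = p ; next-adj = p-adj ; no-return = no-return ; covers = covers }
  where
  open Graph G
  last : Fin n
  last = lastOf c₁ (c₂ ∷ cs)
  open Tree G c₀ last

  closed⁻ = linked-∷ʳ⁻ (c₁ ∷ c₂ ∷ cs) closed

  path = attach-path trivial (c₁ ∷ c₂ ∷ cs) (proj₁ closed⁻) unique
           (All.map (λ { c₀≢ (here refl) → c₀≢ refl }) c₀∉) refl
  t₁ = proj₁ (proj₂ path)
  all = reach-all t₁ (allFin n)
  t = proj₁ (proj₂ all)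
  t₁⊆t = proj₁ (proj₂ (proj₂ all))

  ∈t : ∀ u → u ∈ proj₁ all
  ∈t u = All.lookup (proj₂ (proj₂ (proj₂ all))) (∈-allFin u)

  p : Fin n → Fin n
  p = parent t

  cycle⊆p : Linked (λ a b → p b ≡ a) ((c₀ ∷ c₁ ∷ c₂ ∷ cs) ∷ʳ c₀)
  cycle⊆p = Linked.map (λ { (b∈ , eq) → trans (proj₂ (t₁⊆t b∈)) eq }) (proj₂ (proj₂ (proj₂ path)))

  -- The cycle has at least three vertices, so the predecessor of `last` comes after `c₀`. This
  -- excludes arcs in both directions between `c₀` and `last`.
  p-last≢c₀ : p last ≢ c₀
  p-last≢c₀ eq with linked-predecessor {R = λ a b → p b ≡ a} cs
    (Linked.tail (proj₁ (linked-∷ʳ⁻ (c₁ ∷ c₂ ∷ cs) cycle⊆p)))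
  ... | z , z∈ , pl≡z = All.lookup c₀∉ z∈ (trans (sym eq) pl≡z)

  p-adj : ∀ u → Adj u (p u)
  p-adj u with u Finₚ.≟ c₀
  ... | yes refl = subst (Adj c₀) (sym (parent-root t)) (adj-sym (proj₂ closed⁻))
  ... | no  u≢   = proj₁ (parent-adj t (∈t u) u≢)

  no-return : ∀ u → p (p u) ≢ u
  no-return u eq with u Finₚ.≟ c₀ | p u Finₚ.≟ c₀
  ... | yes refl | _        = p-last≢c₀ (trans (cong p (sym (parent-root t))) eq)
  -- If `p u` is `c₀`, a return makes `u` equal to `last`, and then `p last` would be `c₀`.
  ... | no  _    | yes pu≡  = p-last≢c₀ (trans (cong p last≡u) pu≡)
    where
    last≡u : last ≡ u
    last≡u = trans (sym (parent-root t)) (trans (cong p (sym pu≡)) eq)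
  ... | no  u≢   | no  pu≢  = parent-parent t (∈t u) u≢ pu≢ eq

  Joined : Fin n → Fin n → Set
  Joined u v = p u ≡ v ⊎ p v ≡ u

  joined⇒adj : ∀ {u v} → Joined u v → Adj u v
  joined⇒adj {u} (inj₁ refl) = p-adj u
  joined⇒adj {v = v} (inj₂ refl) = adj-sym (p-adj v)

  joined-connected : ∀ u v → Star Joined u v
  joined-connected u v = Star.map inj₁ (to-root t p (λ _ → refl) (∈t u))
    ◅◅ Star.reverse Sum.swap (Star.map inj₁ (to-root t p (λ _ → refl) (∈t v)))

  c⊆joined : ∀ {u v} → Cycle.IsEdge c u v → Joined u v
  c⊆joined (inj₁ (xs , ys , eq)) = inj₂ (linked-lookup xs (subst (Linked _) eq cycle⊆p))
  c⊆joined (inj₂ (xs , ys , eq)) = inj₁ (linked-lookup xs (subst (Linked _) eq cycle⊆p))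

  -- An edge of G that is not of the form {u , p u} would close a simple path
  -- of such edges to a cycle different from c.
  close-cycle : ∀ {u v} → Adj u v → ¬ Joined u v → Σ[ c′ ∈ Cycle G ] Cycle.IsEdge c′ v u
  close-cycle {u} {v} e ¬j with star⇒simplePath Joined (joined-connected u v)
  -- A path without steps would make `e` a loop, and a single step would join `u` and `v`; any other
  -- path has at least three vertices.
  ... | [] , nil , _ = ⊥-elim (subst T (loopless u) e)
  ... | _ ∷ [] , cons j nil , _ = ⊥-elim (¬j j)
  ... | x ∷ y ∷ l , w , distinct = record
    { start = u ; rest = x ∷ y ∷ l ; distinct = distinct ; long = s≤s (s≤s (s≤s z≤n))
    ; closed = walk-∷ʳ joined⇒adj w (adj-sym e) }
    , inj₁ (let xs , eq = walk-last u w in xs , [] , eq)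

  covers : ∀ {u v} → Adj u v → Joined u v
  -- By uniqueness the edge of the new cycle lies on `c`, whose edges are all `Joined`. The indirect
  -- argument is allowed because equality of vertices is decidable.
  covers {u} {v} e = decidable-stable (p u Finₚ.≟ v ⊎-dec p v Finₚ.≟ u) λ ¬j →
    let c′ , edge = close-cycle e ¬j
    in ¬j (Sum.swap (c⊆joined (Equivalence.from (c-unique c′ v u) edge)))

-- Degree sums

bit : Bool → ℕ
bit b = if b then 1 else 0

∣tabulate∣≡∑ : ∀ {n} (f : Fin n → Bool) → ∣ Vec.tabulate f ∣ ≡ ∑ (bit ∘ f)
∣tabulate∣≡∑ {zero}  f = refl
∣tabulate∣≡∑ {suc n} f with f zero
... | true  = cong suc (∣tabulate∣≡∑ (f ∘ suc))
... | false = ∣tabulate∣≡∑ (f ∘ suc)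

∑-zero : ∀ n → ∑ {n} (λ _ → 0) ≡ 0
∑-zero zero    = refl
∑-zero (suc n) = ∑-zero n

∑-one : ∀ n → ∑ {n} (λ _ → 1) ≡ n
∑-one zero    = refl
∑-one (suc n) = cong suc (∑-one n)

∑-indicator : ∀ {n} (a : Fin n) → ∑ (λ y → bit (does (a Finₚ.≟ y))) ≡ 1
∑-indicator {suc n} zero    = cong suc (∑-zero n)
∑-indicator {suc n} (suc a) = ∑-indicator a

∑-positive : ∀ {n} (f : Fin n → ℕ) i → 1 ≤ f i → 1 ≤ ∑ f
∑-positive f zero    1≤ = ℕₚ.≤-trans 1≤ (ℕₚ.m≤m+n (f zero) _)
∑-positive f (suc i) 1≤ = ℕₚ.≤-trans (∑-positive (f ∘ suc) i 1≤) (ℕₚ.m≤n+m _ (f zero))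

sum-tabulate : ∀ {n} (f : Fin n → ℕ) → sum (List.tabulate f) ≡ ∑ f
sum-tabulate {zero}  f = refl
sum-tabulate {suc n} f = cong (f zero +_) (sum-tabulate (f ∘ suc))

module _ {n : ℕ} (G : Graph n) where
  open Graph G

  excess : Fin n → ℕ
  excess u = degree u ∸ 1

  excesses : List ℕ
  excesses = map excess (allFin n)

module _ {n : ℕ} {G : Graph n} (o : Orientation G) where
  open Graph G
  open Orientation o

  indegree : Fin n → ℕ
  indegree u = ∑ (λ v → bit (does (next v Finₚ.≟ u)))

  -- An edge is an arc in exactly one direction: `covers` gives at least one, `no-return` at most
  -- one.
  adj-bit : ∀ u v → bit (adj u v) ≡ bit (does (next u Finₚ.≟ v)) + bit (does (next v Finₚ.≟ u))
  adj-bit u v with next u Finₚ.≟ v | next v Finₚ.≟ u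
  ... | yes refl | yes eq  = ⊥-elim (no-return u eq)
  ... | yes refl | no _    rewrite Equivalence.to T-≡ (next-adj u) = refl
  ... | no _     | yes refl rewrite symmetric (next v) v | Equivalence.to T-≡ (next-adj v) = refl
  ... | no ¬p    | no ¬q with adj u v in eq
  ...   | false = refl
  ...   | true  = ⊥-elim ([ ¬p , ¬q ]′ (covers (Equivalence.from T-≡ eq)))

  -- In the sum of `adj-bit` over all `v`, the single outgoing arc of `u` contributes the 1.
  degree≡1+indegree : ∀ u → degree u ≡ 1 + indegree u
  degree≡1+indegree u = trans (∣tabulate∣≡∑ (adj u)) (trans (sum-cong-≗ (adj-bit u))
    (trans (∑-distrib-+ {n} _ _) (cong (_+ indegree u) (∑-indicator (next u)))))

  -- Double counting of arcs: each vertex is the tail of one.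
  ∑-indegree : ∑ indegree ≡ n
  ∑-indegree = trans (∑-comm {n} {n} (λ u v → bit (does (next v Finₚ.≟ u))))
    (trans (sum-cong-≗ (λ v → ∑-indicator (next v))) (∑-one n))

  indegree-next : ∀ u → 1 ≤ indegree (next u)
  indegree-next u = ∑-positive _ u
    (ℕₚ.≤-reflexive (cong bit (sym (dec-true (next u Finₚ.≟ next u) refl))))

  excess≡indegree : ∀ u → excess G u ≡ indegree u
  excess≡indegree u = cong (_∸ 1) (degree≡1+indegree u)

  sum-excesses : sum (excesses G) ≡ n
  sum-excesses = trans (cong sum (Listₚ.map-tabulate id (excess G)))
    (trans (sum-tabulate (excess G)) (trans (sum-cong-≗ excess≡indegree) ∑-indegree))

-- Bounds on I

-- Proofs of `1 ≤ j` are unique, so the values are equal up to `≡`, which permits rewriting inside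
-- sums.
shifted-≡ : ∀ f {j k} (1≤j : 1 ≤ j) → j ≡ suc k → f ⟨$⟩ point j 1≤j ≡ shifted f k
shifted-≡ f {k = k} 1≤j refl = cong (λ p → f ⟨$⟩ point (suc k) p) (ℕₚ.≤-irrelevant 1≤j (s≤s z≤n))

bound₁≈Σℝ : ∀ f c {D m} (1≤Δ : 1 ≤ suc D) (1≤m : 1 ≤ m + 1) →
  (f ⟨$⟩ point (suc D) 1≤Δ) +ℝ (f ⟨$⟩ point (m + 1) 1≤m) +ℝ shifted f 1 +ℝ fromℕ c *ℝ shifted f 0
    ≈ℝ Σℝ (shifted f) (D ∷ m ∷ 1 ∷ replicate c 0)
bound₁≈Σℝ f c {D} {m} 1≤Δ 1≤m = subst (_≈ℝ Σℝ g zs)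
  (sym (cong₂ (λ x y → x +ℝ y +ℝ g 1 +ℝ fromℕ c *ℝ g 0)
    (shifted-≡ f 1≤Δ refl) (shifted-≡ f 1≤m (ℕₚ.+-comm m 1))))
  (pointwise {g D +ℝ g m +ℝ g 1 +ℝ fromℕ c *ℝ g 0} {Σℝ g zs} λ k → trans
    (solve 4 (λ x y z w → x :+ y :+ z :+ w := x :+ (y :+ (z :+ w))) refl
      (seq (g D) k) (seq (g m) k) (seq (g 1) k) (ι c ℚ.* seq (g 0) k))
    (cong (λ e → seq (g D) k ℚ.+ (seq (g m) k ℚ.+ (seq (g 1) k ℚ.+ e)))
      (sym (Σℝ-replicate g c 0 k))))
  where
  g = shifted f
  zs = D ∷ m ∷ 1 ∷ replicate c 0

bound₂≈Σℝ : ∀ f q c {D m} (1≤Δ : 1 ≤ suc D) (1≤m : 1 ≤ m + 1) →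
  fromℕ q *ℝ (f ⟨$⟩ point (suc D) 1≤Δ) +ℝ (f ⟨$⟩ point (m + 1) 1≤m) +ℝ fromℕ c *ℝ shifted f 0
    ≈ℝ Σℝ (shifted f) (replicate q D ++ m ∷ replicate c 0)
bound₂≈Σℝ f q c {D} {m} 1≤Δ 1≤m = subst (_≈ℝ Σℝ g zs)
  (sym (cong₂ (λ x y → fromℕ q *ℝ x +ℝ y +ℝ fromℕ c *ℝ g 0)
    (shifted-≡ f 1≤Δ refl) (shifted-≡ f 1≤m (ℕₚ.+-comm m 1))))
  (pointwise {fromℕ q *ℝ g D +ℝ g m +ℝ fromℕ c *ℝ g 0} {Σℝ g zs} λ k → sym (trans
    (Σℝ-replicate-++ g q D (m ∷ replicate c 0) k)
    (trans (cong (λ e → ι q ℚ.* seq (g D) k ℚ.+ (seq (g m) k ℚ.+ e)) (Σℝ-replicate g c 0 k))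
      (sym (ℚₚ.+-assoc (ι q ℚ.* seq (g D) k) (seq (g m) k) (ι c ℚ.* seq (g 0) k))))))
  where
  g = shifted f
  zs = replicate q D ++ m ∷ replicate c 0

module _ {n : ℕ} (G : Graph n) where
  open Graph G

  suc-excess : ∀ u → degree u ≡ suc (excess G u)
  suc-excess u = sym (ℕₚ.m+[n∸m]≡n (degree≥1 u))

  degrees≡ : degrees ≡ map suc (excesses G)
  degrees≡ = trans (Listₚ.map-cong suc-excess (allFin n)) (Listₚ.map-∘ (allFin n))

  I≡Σℝ : ∀ f → I G f ≡ Σℝ (shifted f) (excesses G)
  I≡Σℝ f = cong (foldr _+ℝ_ 0ℝ) (trans
    (Listₚ.map-cong (λ u → shifted-≡ f (degree≥1 u) (suc-excess u)) (allFin n))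
    (Listₚ.map-∘ (allFin n)))

  -- The common end of both cases: once the excesses are majorised by the extremal ones, convexity
  -- gives the bound and strict convexity its equality case.
  sharp : ∀ {Δ zs B} (3≤Δ : 3 ≤ Δ) → Unicyclic G → extremalSequence n Δ 3≤Δ ≡ map suc zs →
          Linked _≥_ zs → excesses G ⊑ zs →
          (∀ f → B f ≈ℝ Σℝ (shifted f) zs) → SharpUpperBound G B (In𝒦 Δ 3≤Δ G)
  sharp {Δ} {zs} {B} 3≤Δ unicyclic seq≡ sorted majorised B≈ =
      (λ f cvx → ≤ℝ-trans {I G f} {Σℝ (shifted f) zs} {B f}
        (subst (_≤ℝ Σℝ (shifted f) zs) (sym (I≡Σℝ f))
          (⊑-convex {shifted f} (convex⇒convexℕ f cvx) majorised))
        (≈⇒≤ {Σℝ (shifted f) zs} {B f} (≈-sym {B f} {Σℝ (shifted f) zs} (B≈ f))))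
    , mk⇔ (λ attained → attained⇒∈𝒦 square square-strictlyConvexℕ (attained square square-convex))
          (λ G∈𝒦 f _ → ∈𝒦⇒attained G∈𝒦 f)
    , λ f cvx → mk⇔ (attained⇒∈𝒦 f (strictlyConvex⇒strictlyConvexℕ f cvx))
                    (λ G∈𝒦 → ∈𝒦⇒attained G∈𝒦 f)
    where
    attained⇒∈𝒦 : ∀ f → StrictlyConvexℕ (shifted f) → I G f ≈ℝ B f → In𝒦 Δ 3≤Δ G
    attained⇒∈𝒦 f cvx I≈B = [ permuted
      , (λ lt → ⊥-elim (<ℝ⇒≉ {Σℝ (shifted f) (excesses G)} {Σℝ (shifted f) zs} lt
          (subst (_≈ℝ Σℝ (shifted f) zs) (I≡Σℝ f)
            (≈-trans {I G f} {B f} {Σℝ (shifted f) zs} I≈B (B≈ f)))))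
      ]′ (⊑-strictlyConvex {shifted f} {excesses G} {zs} cvx majorised)
      where
      permuted : excesses G ↭ zs → In𝒦 Δ 3≤Δ G
      permuted p = unicyclic , subst (IsDegreeSequence G) (sym seq≡)
        ( Linkedₚ.map⁺ (Linked.map s≤s sorted)
        , subst (map suc zs ↭_) (sym degrees≡) (map⁺ suc (↭-sym p)))

    -- The value `I G f` depends only on the degrees up to rearrangement.
    ∈𝒦⇒attained : In𝒦 Δ 3≤Δ G → ∀ f → I G f ≈ℝ B f
    ∈𝒦⇒attained (_ , _ , p) f = subst (_≈ℝ B f) (sym (I≡Σℝ f))
      (≈-trans {Σℝ (shifted f) (excesses G)} {Σℝ (shifted f) zs} {B f}
        (Σℝ-↭ (shifted f) (↭-sym (subst₂ _↭_ (map-pred-suc zs) (map-pred-suc (excesses G))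
          (map⁺ ℕ.pred (subst₂ _↭_ seq≡ degrees≡ p)))))
        (≈-sym {B f} {Σℝ (shifted f) zs} (B≈ f)))
      where
      map-pred-suc : ∀ xs → map ℕ.pred (map suc xs) ≡ xs
      map-pred-suc xs = trans (sym (Listₚ.map-∘ xs)) (Listₚ.map-id xs)

-- Sorted lists and extraction of entries

sorted-replicate-++ : ∀ k {x y ys} → y ≤ x → Linked _≥_ (y ∷ ys) →
  Linked _≥_ (replicate k x ++ y ∷ ys)
sorted-replicate-++ zero          y≤x l = l
sorted-replicate-++ (suc zero)    y≤x l = y≤x ∷ l
sorted-replicate-++ (suc (suc k)) y≤x l = ≤-refl ∷ sorted-replicate-++ (suc k) y≤x l

sorted-zeros : ∀ x k → Linked _≥_ (x ∷ replicate k 0)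
sorted-zeros x zero    = [-]
sorted-zeros x (suc k) = z≤n ∷ sorted-zeros 0 k

pull : ∀ {A : Set} {x : A} {xs} → x ∈ xs → ∃[ ys ] (xs ↭ x ∷ ys)
pull {x = x} x∈ with ∈-∃++ x∈
... | ys , zs , refl = ys ++ zs , shift x ys zs

∈-tail : ∀ {A : Set} {x y : A} {xs} → x ≢ y → x ∈ y ∷ xs → x ∈ xs
∈-tail x≢y (here refl) = ⊥-elim (x≢y refl)
∈-tail x≢y (there x∈)  = x∈

-- Distinctness ensures that `y` and `z` survive the removal of the elements taken out before them.
pull₃ : ∀ {A : Set} {x y z : A} {xs} → x ∈ xs → y ∈ xs → z ∈ xs → y ≢ x → z ≢ x → z ≢ y →
        ∃[ ys ] (xs ↭ x ∷ y ∷ z ∷ ys)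
pull₃ {x = x} {y} x∈ y∈ z∈ y≢x z≢x z≢y =
  let xs₁ , p = pull x∈
      xs₂ , q = pull (∈-tail y≢x (∈-resp-↭ p y∈))
      xs₃ , r = pull (∈-tail z≢y (∈-resp-↭ q (∈-tail z≢x (∈-resp-↭ p z∈))))
  in xs₃ , Perm.trans p (Perm.prep x (Perm.trans q (Perm.prep y r)))

-- The two cases of the bound, with `D` for Δ - 1

module _ {n D : ℕ} (3≤Δ : 3 ≤ suc D) (G : Graph n) (unicyclic : Unicyclic G) where
  open Graph G

  private
    instance
      D-nonZero : NonZero D
      D-nonZero = ℕ.>-nonZero (ℕₚ.m<n⇒0<n∸m (≤-trans (ℕₚ.n≤1+n 2) 3≤Δ))

    o : Orientation G
    o = unicyclic⇒orientation G unicyclic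
    open Orientation o

    q = quotient n (suc D) 3≤Δ

    E = excesses G

  length-excesses : length E ≡ n
  length-excesses = trans (Listₚ.length-map _ (allFin n)) (Listₚ.length-tabulate id)

  -- The vertex `next u` has the incoming arc from `u`.
  excess-next : ∀ u → ∃[ a ] (excess G (next u) ≡ suc a)
  excess-next u with excess G (next u)
                   | subst (1 ≤_) (sym (excess≡indegree o (next u))) (indegree-next o u)
  ... | suc a | _ = a , refl

  -- Besides a vertex u of maximum degree, next u and next (next u) have
  -- degree at least 2.
  excesses-majorised₁ : IsMaxDegree G (suc D) →
    suc D < n × (E ⊑ D ∷ (n ∸ suc D) ∷ 1 ∷ replicate (n ∸ 3) 0)
  excesses-majorised₁ (_ , u , u-max)
    -- The three vertices are distinct: consecutive ones because there are no loops, the outer two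
    -- by `no-return`.
    with pull₃ (∈-allFin u) (∈-allFin (next u)) (∈-allFin (next (next u)))
           (next≢ u) (no-return u) (next≢ (next u))
       | excess-next u | excess-next (next u)
    where
    next≢ : ∀ u → next u ≢ u
    next≢ u eq = subst T (loopless u) (subst (Adj u) eq (next-adj u))
  ... | us , p | a , a≡ | b , b≡ =
    let Δ<n , m = ⊑-three-heavy rest (trans (sym (↭-length p′)) length-excesses)
                    (trans (sym (sum-↭ p′)) (sum-excesses o))
    in Δ<n , (perm p′ then m)
    where
    rest = map (excess G) us
    p′ : E ↭ D ∷ suc a ∷ suc b ∷ rest
    p′ = subst (E ↭_)
      (cong₂ _∷_ (cong (_∸ 1) u-max) (cong₂ (λ x y → x ∷ y ∷ rest) a≡ b≡)) (map⁺ _ p)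

  -- Puts the first two entries of the extremal sequence in order. Either alternative gives
  -- `n ≤ D + D`: the first by division with remainder, the second because 2Δ - 2 is 2D.
  small-remainder : q ≡ 1 ⊎ n ≡ 2 * suc D ∸ 2 → n ∸ suc D ≤ D
  small-remainder (inj₁ q≡1) = ℕₚ.m≤n+o⇒m∸n≤o n (suc D) (ℕₚ.<⇒≤ (begin-strict
    n                 ≡⟨ DivMod.m≡m%n+[m/n]*n n D ⟩
    n ℕ.% D + q * D   ≡⟨ cong (λ k → n ℕ.% D + k * D) q≡1 ⟩
    n ℕ.% D + 1 * D   ≡⟨ cong (n ℕ.% D +_) (ℕₚ.*-identityˡ D) ⟩
    n ℕ.% D + D       <⟨ ℕₚ.+-monoˡ-< D (DivMod.m%n<n n D) ⟩
    D + D             ≤⟨ ℕₚ.n≤1+n (D + D) ⟩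
    suc D + D         ∎))
    where open ℕₚ.≤-Reasoning
  small-remainder (inj₂ refl) = ℕₚ.m≤n+o⇒m∸n≤o (2 * suc D ∸ 2) (suc D) (begin
    2 * suc D ∸ 2     ≤⟨ ℕₚ.∸-monoʳ-≤ (2 * suc D) (s≤s {0} {1} z≤n) ⟩
    2 * suc D ∸ 1     ≡⟨ ℕₚ.+-suc D (D + 0) ⟩
    suc D + (D + 0)   ≡⟨ cong (suc D +_) (ℕₚ.+-identityʳ D) ⟩
    suc D + D         ∎)
    where open ℕₚ.≤-Reasoning

  bound₁ bound₂ : 1 ≤ suc D → ∀ {m} → 1 ≤ m + 1 → RealFunction → ℝ
  bound₁ 1≤Δ {m} 1≤m+1 f =
    (f ⟨$⟩ point (suc D) 1≤Δ) +ℝ (f ⟨$⟩ point (m + 1) 1≤m+1)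
    +ℝ (f ⟨$⟩ point 2 (m≤n+m 1 1)) +ℝ fromℕ (n ∸ 3) *ℝ (f ⟨$⟩ point 1 ≤-refl)
  bound₂ 1≤Δ {m} 1≤m+1 f =
    fromℕ q *ℝ (f ⟨$⟩ point (suc D) 1≤Δ) +ℝ (f ⟨$⟩ point (m + 1) 1≤m+1)
    +ℝ fromℕ (n ∸ q ∸ 1) *ℝ (f ⟨$⟩ point 1 ≤-refl)

  case₁ : IsMaxDegree G (suc D) → q ≡ 1 ⊎ n ≡ 2 * suc D ∸ 2 → ∀ 1≤Δ 1≤m →
    SharpUpperBound G (bound₁ 1≤Δ {n ∸ suc D} 1≤m) (In𝒦 (suc D) 3≤Δ G)
  case₁ Δ-max h 1≤Δ 1≤m =
    let Δ<n , majorised = excesses-majorised₁ Δ-max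
    in sharp G {B = bound₁ 1≤Δ {n ∸ suc D} 1≤m} 3≤Δ unicyclic seq≡
         (small-remainder h ∷ ℕₚ.m<n⇒0<n∸m Δ<n ∷ sorted-zeros 1 (n ∸ 3)) majorised B≈
    where
    zs = D ∷ (n ∸ suc D) ∷ 1 ∷ replicate (n ∸ 3) 0
    seq≡ : extremalSequence n (suc D) 3≤Δ ≡ map suc zs
    seq≡ rewrite dec-true ((q ℕ.≟ 1) ⊎-dec (n ℕ.≟ 2 * suc D ∸ 2)) h =
      cong₂ (λ m xs → suc D ∷ m ∷ 2 ∷ xs) (ℕₚ.+-comm (n ∸ suc D) 1)
        (sym (Listₚ.map-replicate suc (n ∸ 3) 0))
    B≈ : ∀ f → bound₁ 1≤Δ {n ∸ suc D} 1≤m f ≈ℝ Σℝ (shifted f) zs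
    B≈ f = bound₁≈Σℝ f (n ∸ 3) 1≤Δ 1≤m

  case₂ : 4 ≤ n → IsMaxDegree G (suc D) → 1 < q → n ≢ 2 * suc D ∸ 2 → ∀ 1≤Δ 1≤m →
    SharpUpperBound G (bound₂ 1≤Δ {n ∸ q * D} 1≤m) (In𝒦 (suc D) 3≤Δ G)
  case₂ 4≤n (≤Δ , _) 1<q n≢ 1≤Δ 1≤m =
    sharp G {zs = zs} {B = bound₂ 1≤Δ {n ∸ q * D} 1≤m} 3≤Δ unicyclic seq≡ sorted majorised B≈
    where
    zs = replicate q D ++ (n ∸ q * D) ∷ replicate (n ∸ (q + 1)) 0
    sorted : Linked _≥_ zs
    sorted = sorted-replicate-++ q
      (ℕₚ.<⇒≤ (subst (_< D) (DivMod.m%n≡m∸m/n*n n D) (DivMod.m%n<n n D)))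
      (sorted-zeros (n ∸ q * D) (n ∸ (q + 1)))
    majorised : E ⊑ zs
    majorised = ⊑-greedy E (s≤s⁻¹ 3≤Δ) (≤-trans (s≤s z≤n) 4≤n) length-excesses (sum-excesses o)
      (Allₚ.map⁺ (All.universal (λ u → ℕₚ.∸-monoˡ-≤ 1 (≤Δ u)) (allFin n)))
    seq≡ : extremalSequence n (suc D) 3≤Δ ≡ map suc zs
    seq≡ rewrite dec-false ((q ℕ.≟ 1) ⊎-dec (n ℕ.≟ 2 * suc D ∸ 2))
      [ (λ q≡1 → ℕₚ.<-irrefl (sym q≡1) 1<q) , n≢ ]′ =
      sym (trans (Listₚ.map-++ suc (replicate q D) _) (cong₂ _++_ (Listₚ.map-replicate suc q D)
        (cong₂ _∷_ (ℕₚ.+-comm 1 (n ∸ q * D)) (Listₚ.map-replicate suc (n ∸ (q + 1)) 0))))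
    B≈ : ∀ f → bound₂ 1≤Δ {n ∸ q * D} 1≤m f ≈ℝ Σℝ (shifted f) zs
    -- The bound counts the vertices of degree 1 as `n ∸ q ∸ 1`, the extremal sequence as
    -- `n ∸ (q + 1)`.
    B≈ f = subst
      (λ c → fromℕ q *ℝ (f ⟨$⟩ point (suc D) 1≤Δ) +ℝ (f ⟨$⟩ point (n ∸ q * D + 1) 1≤m)
             +ℝ fromℕ c *ℝ shifted f 0 ≈ℝ Σℝ (shifted f) zs)
      (sym (ℕₚ.∸-+-assoc n q 1)) (bound₂≈Σℝ f q (n ∸ (q + 1)) 1≤Δ 1≤m)

theorem4p4 : ∀ {n Δ : ℕ} (4≤n : 4 ≤ n) (3≤Δ : 3 ≤ Δ) (G : Graph n) →
    Unicyclic G → IsMaxDegree G Δ →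
    let q = quotient n Δ 3≤Δ in
    (q ≡ 1 ⊎ n ≡ 2 * Δ ∸ 2 →
    SharpUpperBound G
    (λ f → (f ⟨$⟩ point Δ (≤-trans (m≤n+m 1 2) 3≤Δ))
    +ℝ (f ⟨$⟩ point (n ∸ Δ + 1) (m≤n+m 1 (n ∸ Δ)))
    +ℝ (f ⟨$⟩ point 2 (m≤n+m 1 1))
    +ℝ fromℕ (n ∸ 3) *ℝ (f ⟨$⟩ point 1 ≤-refl))
    (In𝒦 Δ 3≤Δ G))
    × (1 < q → n ≢ 2 * Δ ∸ 2 →
    SharpUpperBound G
    (λ f → fromℕ q *ℝ (f ⟨$⟩ point Δ (≤-trans (m≤n+m 1 2) 3≤Δ))
    +ℝ (f ⟨$⟩ point (n ∸ q * (Δ ∸ 1) + 1) (m≤n+m 1 (n ∸ q * (Δ ∸ 1))))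
    +ℝ fromℕ (n ∸ q ∸ 1) *ℝ (f ⟨$⟩ point 1 ≤-refl))
    (In𝒦 Δ 3≤Δ G))
theorem4p4 {n} {suc D} 4≤n 3≤Δ G unicyclic Δ-max =
    (λ h → case₁ 3≤Δ G unicyclic Δ-max h (≤-trans (m≤n+m 1 2) 3≤Δ) (m≤n+m 1 (n ∸ suc D)))
  , (λ 1<q n≢ → case₂ 3≤Δ G unicyclic 4≤n Δ-max 1<q n≢
      (≤-trans (m≤n+m 1 2) 3≤Δ) (m≤n+m 1 (n ∸ quotient n (suc D) 3≤Δ * D)))
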